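{- Let $G$ be an undirected graph of order $n$, and let $G'$ be the labeled multistage graph constructed from $G$. The complexity of transforming $G$ into $G'$ is a polynomial function of $n$.
   Context: A labeled multistage graph $\langle V,E,S,D,L\rangle$ is a finite directed graph such that: (1) $V=V_0\cup V_1\cup\dots\cup V_L$ with $V_i\cap V_j=\emptyset$ for $i\neq j$; a vertex $u \in V_i$ is said to be of stage $i$; (2) $E$ is a set of directed edges, each written as a triple $\langle u,v,l\rangle$ (an edge of stage $l$), where $1\le l\le L$, $u\in V_{l-1}$, $v\in V_l$; (3) $V_0=\{S\}$ and $V_L=\{D\}$; (4) each $v\in V\setminus\{S\}$ is labeled with a subset $E(v)\subseteq E$. Construction of $G'=\langle V',E',S,D,L\rangle$ from $G=\langle V,E\rangle$ of order $n$: (1) $L=n$. (2) Select a vertex $v\in V$; put vertices $(v,0)$ and $(v,n)$ in $V'$; let $S=(v,0)$, $D=(v,n)$. (3) For all $u\in V\setminus\{v\}$, put in $V'$ the vertices $(u,1)$ of stage $1$, $(u,2)$ of stage $2$, ..., $(u,L-1)$ of stage $L-1$. (4) For all $(a,b)\in E$ with $a\neq v$, $b\neq v$, put in $E'$ the edges $\langle(a,1),(b,2),2\rangle,\dots,\langle(a,L-2),(b,L-1),L-1\rangle$ and $\langle(b,1),(a,2),2\rangle,\dots,\langle(b,L-2),(a,L-1),L-1\rangle$; for all $(v,b)\in E$, put in $E'$ the edge from $(v,0)$ to $(b,1)$ (stage $1$) and the edge from $(b,L-1)$ to $(v,n)$ (stage $L$). (5) $E(u,l)=E'\setminus\{e\in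 E'\mid e \text{ is incident with } (u,1),\dots,\text{ or } (u,l-1)\}$ for $1\le l\le L-1$. (6) $E(D)=E(v,n)=E'$. -}

module Defs where

open import Data.Bool using (Bool; true; false; T)
open import Data.Fin using (Fin; toℕ)
import Data.Fin as Fin
open import Data.List using (List; []; _∷_; foldr; map; tabulate; allFin; upTo; cartesianProduct)
open import Data.List.Membership.Propositional using (_∈_)
open import Data.List.Membership.Propositional.Properties
  using (∈-cartesianProduct⁺; ∈-allFin; ∈-upTo⁺)
open import Data.List.Relation.Unary.All using (All)
open import Data.List.Relation.Unary.Unique.Propositional using (Unique)
open import Data.Nat using (ℕ; zero; suc; _+_; _*_; _∸_; _≤_; z≤n; s≤s)
open import Data.Nat.Properties
  using (≤-refl; ≤-trans; m∸n≤m; n≤1+n; n≮n)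
open import Data.Product using (Σ; ∃; _×_; _,_; proj₁; proj₂)
open import Data.Sum using (_⊎_)
open import Data.Vec using (Vec; lookup; replicate; head) renaming (_∷_ to _∷ᵛ_; _[_]≔_ to _[_≔_])
open import Function.Bundles using (_⇔_; mk⇔)
open import Level using (0ℓ)
open import Relation.Binary.PropositionalEquality
  using (_≡_; _≢_; refl; sym; trans; cong)
open import Relation.Nullary using (¬_; contradiction)
open import Relation.Unary using (Pred)

-- Undirected (simple, finite) graphs of order n, with vertex set Fin n.

record Graph (n : ℕ) : Set where
  field
    adjacent    : Fin n → Fin n → Bool
    symmetric   : ∀ a b → adjacent a b ≡ adjacent b a
    irreflexive : ∀ a → adjacent a a ≡ false

  Adj : Fin n → Fin n → Set
  Adj a b = T (adjacent a b)

-- ⟨ u , w , l ⟩ is the edge of stage l from u to w.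

record Edge (A : Set) : Set where
  constructor ⟨_,_,_⟩
  field
    src tgt : A
    level   : ℕ

open Edge public

Incident : ∀ {A : Set} → Edge A → A → Set
Incident e x = (src e ≡ x) ⊎ (tgt e ≡ x)

-- Labeled multistage graphs whose vertices are named by elements of A.
-- Only stage 0, …, stage L, and label x for x ∈ V∖{S}, are meaningful.

record LabeledMultistageGraph (A : Set) : Set₁ where
  field
    L     : ℕ
    stage : ℕ → Pred A 0ℓ
    E     : Pred (Edge A) 0ℓ
    S D   : A
    label : A → Pred (Edge A) 0ℓ

  V : Pred A 0ℓ
  V x = ∃ λ i → i ≤ L × stage i x

  field
    finite   : ∃ λ xs → ∀ {x} → V x → x ∈ xs
    disjoint : ∀ {i j x} → i ≤ L → j ≤ L → i ≢ j → stage i x → ¬ stage j x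
    edges    : ∀ {u w l} → E ⟨ u , w , l ⟩ →
               1 ≤ l × l ≤ L × stage (l ∸ 1) u × stage l w
    initial  : ∀ {x} → stage 0 x ⇔ x ≡ S
    final    : ∀ {x} → stage L x ⇔ x ≡ D
    labels   : ∀ {x e} → V x → x ≢ S → label x e → E e

-- The construction of G′ from G and the selected vertex v.

module Construction {n : ℕ} (G : Graph n) (v : Fin n) where

  open Graph G

  Vertex : Set
  Vertex = Fin n × ℕ

  data Stage′ : ℕ → Pred Vertex 0ℓ where
    source : Stage′ 0 (v , 0)
    inner  : ∀ {u l} → u ≢ v → 1 ≤ l → l ≤ n ∸ 1 → Stage′ l (u , l)
    sink   : Stage′ n (v , n)

  data E′ : Pred (Edge Vertex) 0ℓ where
    forward  : ∀ {a b l} → Adj a b → a ≢ v → b ≢ v → 1 ≤ l → l ≤ n ∸ 2 →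
               E′ ⟨ (a , l) , (b , suc l) , suc l ⟩
    backward : ∀ {a b l} → Adj a b → a ≢ v → b ≢ v → 1 ≤ l → l ≤ n ∸ 2 →
               E′ ⟨ (b , l) , (a , suc l) , suc l ⟩
    leave    : ∀ {b} → Adj v b → E′ ⟨ (v , 0) , (b , 1) , 1 ⟩
    return   : ∀ {b} → Adj v b → E′ ⟨ (b , n ∸ 1) , (v , n) , n ⟩

  data Label′ : Vertex → Pred (Edge Vertex) 0ℓ where
    inner : ∀ {u l e} → 1 ≤ l → l ≤ n ∸ 1 → E′ e →
            (∀ k → 1 ≤ k → k ≤ l ∸ 1 → ¬ Incident e (u , k)) →
            Label′ (u , l) e
    sink  : ∀ {e} → E′ e → Label′ (v , n) e

  private
    pos : ∀ {m} → Fin m → 1 ≤ m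
    pos {suc m} _ = s≤s z≤n

    two : ∀ {m} {a b : Fin m} → a ≢ b → 1 ≤ m ∸ 1
    two {suc zero}    {Fin.zero} {Fin.zero} a≢b = contradiction refl a≢b
    two {suc (suc m)} _ = s≤s z≤n

    suc-pred : ∀ {m} → 1 ≤ m → m ≤ m ∸ 1 → 1 ≤ 0
    suc-pred {suc m} _ p = contradiction p (n≮n m)

    ∸2⇒∸1 : ∀ {m l} → 1 ≤ l → l ≤ m ∸ 2 → suc l ≤ m ∸ 1
    ∸2⇒∸1 {suc (suc m)} _ p = s≤s p
    ∸2⇒∸1 {suc zero} (s≤s _) ()
    ∸2⇒∸1 {zero}     (s≤s _) ()

    neighbour≢v : ∀ {b} → Adj v b → b ≢ v
    neighbour≢v p refl with adjacent v v | irreflexive v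
    neighbour≢v () refl | .false | refl

    stage≡ : ∀ {i x} → Stage′ i x → proj₂ x ≡ i
    stage≡ source        = refl
    stage≡ (inner _ _ _) = refl
    stage≡ sink          = refl

    middle : ∀ {a b l} → a ≢ v → b ≢ v → 1 ≤ l → l ≤ n ∸ 2 →
             1 ≤ suc l × suc l ≤ n × Stage′ l (a , l) × Stage′ (suc l) (b , suc l)
    middle a≢v b≢v 1≤l l≤ =
      s≤s z≤n , ≤-trans l<n-1 (m∸n≤m n 1) ,
      inner a≢v 1≤l (≤-trans (n≤1+n _) l<n-1) , inner b≢v (s≤s z≤n) l<n-1
      where l<n-1 = ∸2⇒∸1 {n} 1≤l l≤

    edges′ : ∀ {u w l} → E′ ⟨ u , w , l ⟩ →
             1 ≤ l × l ≤ n × Stage′ (l ∸ 1) u × Stage′ l w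
    edges′ (forward  _ a≢v b≢v 1≤l l≤) = middle a≢v b≢v 1≤l l≤
    edges′ (backward _ a≢v b≢v 1≤l l≤) = middle b≢v a≢v 1≤l l≤
    edges′ (leave p)  = ≤-refl , pos v , source , inner b≢v ≤-refl (two b≢v)
      where b≢v = neighbour≢v p
    edges′ (return p) = pos v , ≤-refl , inner b≢v (two b≢v) ≤-refl , sink
      where b≢v = neighbour≢v p

    initial⇒ : ∀ {i x} → Stage′ i x → i ≡ 0 → x ≡ (v , 0)
    initial⇒ source          _    = refl
    initial⇒ (inner _ () _)  refl
    initial⇒ sink            refl = refl

    final⇒ : ∀ {i x} → Stage′ i x → i ≡ n → x ≡ (v , n)
    final⇒ source         eq   = cong (v ,_) eq
    final⇒ (inner _ _ l≤) refl = contradiction (suc-pred (pos v) l≤) λ ()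
    final⇒ sink           _    = refl

    finite′ : ∀ {x} → (∃ λ i → i ≤ n × Stage′ i x) →
              x ∈ cartesianProduct (allFin n) (upTo (suc n))
    finite′ {u , l} (i , i≤n , s) with stage≡ s
    ... | refl = ∈-cartesianProduct⁺ (∈-allFin u) (∈-upTo⁺ (s≤s i≤n))

    labels′ : ∀ {x e} → Label′ x e → E′ e
    labels′ (inner _ _ p _) = p
    labels′ (sink p)        = p

  G′ : LabeledMultistageGraph Vertex
  G′ = record
    { L        = n
    ; stage    = Stage′
    ; E        = E′
    ; S        = v , 0
    ; D        = v , n
    ; label    = Label′
    ; finite   = _ , finite′
    ; disjoint = λ _ _ i≢j s t → i≢j (trans (sym (stage≡ s)) (stage≡ t))
    ; edges    = edges′
    ; initial  = mk⇔ (λ s → initial⇒ s refl) λ { refl → source }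
    ; final    = mk⇔ (λ s → final⇒ s refl) λ { refl → sink }
    ; labels   = λ _ _ → labels′
    }

open Construction public using (G′)

-- The model of computation is the WHILE language over binary trees with its
-- usual time measure (N. D. Jones, Computability and Complexity from a
-- Programming Perspective); its polynomial-time decidable sets are those of
-- Turing machines.  The conditional, definable there, is taken as primitive.

infixr 5 _∙_

data Tree : Set where
  nil : Tree
  _∙_ : Tree → Tree → Tree

left right : Tree → Tree
left nil      = nil
left (s ∙ t)  = s
right nil     = nil
right (s ∙ t) = t

data Expr (k : ℕ) : Set where
  var   : Fin k → Expr k
  nil   : Expr k
  cons  : Expr k → Expr k → Expr k
  hd tl : Expr k → Expr k

infixr 4 _⨾_
infix  5 _:=_
infix  5 if_then_else_ while_repeat_

data Cmd (k : ℕ) : Set where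
  _:=_          : Fin k → Expr k → Cmd k
  _⨾_           : Cmd k → Cmd k → Cmd k
  if_then_else_ : Expr k → Cmd k → Cmd k → Cmd k
  while_repeat_ : Expr k → Cmd k → Cmd k

Store : ℕ → Set
Store k = Vec Tree k

eval : ∀ {k} → Expr k → Store k → Tree
eval (var x)    σ = lookup σ x
eval nil        σ = nil
eval (cons e f) σ = eval e σ ∙ eval f σ
eval (hd e)     σ = left (eval e σ)
eval (tl e)     σ = right (eval e σ)

cost : ∀ {k} → Expr k → ℕ
cost (var x)    = 1
cost nil        = 1
cost (cons e f) = 1 + cost e + cost f
cost (hd e)     = 1 + cost e
cost (tl e)     = 1 + cost e

-- C ⊢ σ ⇓ τ ⟨ t ⟩: started in store σ, C halts in store τ after time t.
-- In tests nil is false and every other tree is true.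

data _⊢_⇓_⟨_⟩ {k : ℕ} : Cmd k → Store k → Store k → ℕ → Set where
  assign  : ∀ {x e σ} →
            (x := e) ⊢ σ ⇓ σ [ x ≔ eval e σ ] ⟨ 1 + cost e ⟩
  seq     : ∀ {C C′ ρ σ τ s t} →
            C ⊢ ρ ⇓ σ ⟨ s ⟩ → C′ ⊢ σ ⇓ τ ⟨ t ⟩ →
            (C ⨾ C′) ⊢ ρ ⇓ τ ⟨ s + t ⟩
  if-yes  : ∀ {e C C′ σ τ t} → eval e σ ≢ nil → C ⊢ σ ⇓ τ ⟨ t ⟩ →
            (if e then C else C′) ⊢ σ ⇓ τ ⟨ 1 + cost e + t ⟩
  if-no   : ∀ {e C C′ σ τ t} → eval e σ ≡ nil → C′ ⊢ σ ⇓ τ ⟨ t ⟩ →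
            (if e then C else C′) ⊢ σ ⇓ τ ⟨ 1 + cost e + t ⟩
  loop    : ∀ {e C ρ σ τ s t} → eval e ρ ≢ nil →
            C ⊢ ρ ⇓ σ ⟨ s ⟩ → (while e repeat C) ⊢ σ ⇓ τ ⟨ t ⟩ →
            (while e repeat C) ⊢ ρ ⇓ τ ⟨ 1 + cost e + s + t ⟩
  exit    : ∀ {e C σ} → eval e σ ≡ nil →
            (while e repeat C) ⊢ σ ⇓ σ ⟨ 1 + cost e ⟩

-- The first variable holds the input at the start and the output at the end;
-- the other k variables are initially nil.

record Program : Set where
  constructor program
  field
    {k}  : ℕ
    body : Cmd (suc k)

Runs : Program → Tree → Tree → ℕ → Set
Runs (program {k} C) input output t =
  Σ (Store (suc k)) λ τ →
    C ⊢ input ∷ᵛ replicate k nil ⇓ τ ⟨ t ⟩ × head τ ≡ output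

-- Encoding of data as trees; numbers are in unary.

⌜_⌝ᵇ : Bool → Tree
⌜ false ⌝ᵇ = nil
⌜ true  ⌝ᵇ = nil ∙ nil

⌜_⌝ⁿ : ℕ → Tree
⌜ zero  ⌝ⁿ = nil
⌜ suc m ⌝ⁿ = nil ∙ ⌜ m ⌝ⁿ

⌜_⌝ˡ : List Tree → Tree
⌜_⌝ˡ = foldr _∙_ nil

-- A graph is presented to a program by its adjacency matrix (a list of rows),
-- together with the selected vertex.

encodeInput : ∀ {n} → Graph n → Fin n → Tree
encodeInput G v =
  ⌜ toℕ v ⌝ⁿ ∙ ⌜ tabulate (λ a → ⌜ tabulate (λ b → ⌜ Graph.adjacent G a b ⌝ᵇ) ⌝ˡ) ⌝ˡ

encodeVertex : ∀ {n} → Fin n × ℕ → Tree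
encodeVertex (u , l) = ⌜ toℕ u ⌝ⁿ ∙ ⌜ l ⌝ⁿ

-- xs lists the elements of the set P, without repetition and in any order.

record Lists {A : Set} (P : Pred A 0ℓ) (xs : List A) : Set where
  field
    unique : Unique xs
    exact  : ∀ {x} → x ∈ xs ⇔ P x

-- Trees representing a labeled multistage graph, given a code for vertices:
-- L, S, D, the vertices with their stages, the edges, and the label sets.

module _ {A : Set} (code : A → Tree) where

  encodeEdge : Edge A → Tree
  encodeEdge ⟨ u , w , l ⟩ = code u ∙ code w ∙ ⌜ l ⌝ⁿ

  encodeEdges : List (Edge A) → Tree
  encodeEdges es = ⌜ map encodeEdge es ⌝ˡ

  record Represents (M : LabeledMultistageGraph A) (t : Tree) : Set where
    open LabeledMultistageGraph M
    field
      vertexList : List (ℕ × A)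
      edgeList   : List (Edge A)
      labelList  : List (A × List (Edge A))
      vertices-ok : Lists (λ (i , x) → i ≤ L × stage i x) vertexList
      edges-ok    : Lists E edgeList
      labelled-ok : Lists (λ x → V x × x ≢ S) (map proj₁ labelList)
      labels-ok   : All (λ (x , es) → Lists (label x) es) labelList
      tree-ok     : t ≡ ⌜ L ⌝ⁿ ∙ code S ∙ code D
                      ∙ ⌜ map (λ (i , x) → ⌜ i ⌝ⁿ ∙ code x) vertexList ⌝ˡ
                      ∙ encodeEdges edgeList
                      ∙ ⌜ map (λ (x , es) → code x ∙ encodeEdges es) labelList ⌝ˡ

-- Polynomials in one variable as lists of coefficients, constant term first.

Polynomial : Set
Polynomial = List ℕ

⟦_⟧ : Polynomial → ℕ → ℕ
⟦ p ⟧ x = foldr (λ c r → c + x * r) 0 p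

{-# OPTIONS --safe #-}

-- G′ is described uniformly.  Call (x , i) admissible if x ≡ v exactly when
-- i ∈ {0 , n}.  The vertices of G′ are the admissible (x , i) with i ≤ n, and its
-- edges are the ⟨(a , j) , (b , j + 1) , j + 1⟩ with a, b adjacent, j < n and both
-- ends admissible.  The label of (u , l) consists of the edges that do not meet
-- (u , 1), …, (u , l − 1); for D this excludes nothing.
-- Hence a fixed number of nested loops over the stages and the vertices of G
-- produces G′.
--
-- These loops are written in a language of terms whose only recursion is a fold
-- with at most spine I steps, where I is the input, of spine n + 1.  The time of
-- the compiled program is therefore bounded by a polynomial in n that is computed
-- from the term alone, whatever the data are.

module Submission where

open import Defs
import Data.Bool as Bool
open import Data.Bool using (Bool; true; false; T; T?)
open import Data.Fin using (Fin; zero; suc; toℕ; fromℕ<)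
open import Data.Fin.Patterns using (0F; 1F; 2F; 4F; 6F; 8F)
open import Data.Fin.Properties
  using (toℕ-injective; toℕ<n; toℕ≤n; toℕ≤pred[n]; toℕ-fromℕ<)
  renaming (_≟_ to _≟ᶠ_; suc-injective to suc-injectiveᶠ)
open import Data.List
  using (List; []; _∷_; foldl; foldr; map; filter; reverse; tabulate; allFin;
         applyUpTo; upTo; downFrom; cartesianProduct; length)
open import Data.List.Membership.Propositional using (_∈_)
open import Data.List.Membership.Propositional.Properties
  using (∈-map⁺; ∈-map⁻; ∈-filter⁺; ∈-filter⁻; ∈-cartesianProduct⁺; ∈-allFin)
open import Data.List.Properties
  using (map-∘; map-tabulate; foldr-cong; foldr-++; foldr-map; length-map; length-reverse;
         length-tabulate; reverse-map; reverse-foldl; reverse-upTo)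
open import Data.List.Relation.Unary.All as All using ()
open import Data.List.Relation.Unary.All.Properties
  using (all-filter) renaming (map⁺ to All-map⁺)
open import Data.List.Relation.Unary.Unique.Propositional using (Unique)
open import Data.List.Relation.Unary.Unique.Propositional.Properties
  using (allFin⁺; cartesianProduct⁺)
  renaming (map⁺ to Unique-map⁺; filter⁺ to Unique-filter⁺)
open import Data.Nat
  using (ℕ; zero; suc; _+_; _*_; _∸_; _⊔_; _≤_; _<_; z≤n; s≤s; s≤s⁻¹)
open import Data.Nat.Properties
open import Data.Nat.Solver using (module +-*-Solver)
open import Data.Product using (Σ; ∃; ∃₂; _×_; _,_; proj₁; proj₂)
open import Data.Sum using (_⊎_; inj₁; inj₂)
open import Data.Vec using (Vec; lookup; head)
  renaming ([] to []ᵛ; _∷_ to _∷ᵛ_; _[_]≔_ to _[_≔_])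
open import Data.Vec.Properties using (lookup∘update; lookup∘update′)
open import Function using (_∘_; id)
open import Function.Bundles using (mk⇔)
open import Level using (0ℓ)
open import Relation.Binary.PropositionalEquality
  using (_≡_; _≢_; refl; sym; trans; cong; cong₂; subst; module ≡-Reasoning)
open import Relation.Nullary using (¬_; Dec; yes; no; contradiction; does)
open import Relation.Nullary.Decidable using (_×-dec_; _⊎-dec_; _→-dec_; ¬?; proof)
open import Relation.Nullary.Reflects using (Reflects; ofʸ; ofⁿ; det)
open import Relation.Unary using (Pred; Decidable)

-- Bounded folds and their compilation

-- In fold xs z b the step b sees the current element as variable 0 and the
-- accumulator as variable 1.

data Term (k : ℕ) : Set where
  input : Term k
  var   : Fin k → Term k
  nil   : Term k
  cons  : Term k → Term k → Term k
  hd tl : Term k → Term k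
  cond  : Term k → Term k → Term k → Term k
  fold  : Term k → Term k → Term (2 + k) → Term k

truthy : Tree → Bool
truthy nil     = false
truthy (_ ∙ _) = true

spine : Tree → ℕ
spine nil     = 0
spine (_ ∙ t) = suc (spine t)

-- The elements of xs beyond the first spine c are ignored.

walk : Tree → (Tree → Tree → Tree) → Tree → Tree → Tree
walk nil     f xs       acc = acc
walk (_ ∙ c) f nil      acc = walk c f nil acc
walk (_ ∙ c) f (x ∙ xs) acc = walk c f xs (f x acc)

den : ∀ {k} → Tree → Term k → Vec Tree k → Tree
den I input        ρ = I
den I (var i)      ρ = lookup ρ i
den I nil          ρ = nil
den I (cons s t)   ρ = den I s ρ ∙ den I t ρ
den I (hd t)       ρ = left (den I t ρ)
den I (tl t)       ρ = right (den I t ρ)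
den I (cond c s t) ρ = Bool.if truthy (den I c ρ) then den I s ρ else den I t ρ
den I (fold xs z b) ρ =
  walk I (λ x acc → den I b (x ∷ᵛ acc ∷ᵛ ρ)) (den I xs ρ) (den I z ρ)

-- Clamping at `K` makes this total, so code can be generated before its space is known; it is
-- injective only up to `K`, whence the hypotheses `d ≤ K` below.
register : ∀ {K} → ℕ → Fin (suc K)
register         zero    = zero
register {zero}  (suc d) = zero
register {suc K} (suc d) = suc (register d)

-- The result goes to register d and the registers below d are preserved; the
-- variables of the term live in the registers listed in at, and the input stays
-- in register 0.

compile : ∀ {k K} → Term k → Vec ℕ k → ℕ → Cmd (suc K)
foldLoop : ∀ {k K} → Term (2 + k) → Vec ℕ k → ℕ → Cmd (suc K)

compile input      at d = register d := var zero
compile (var i)    at d = register d := var (register (lookup at i))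
compile nil        at d = register d := nil
compile (cons s t) at d =
  compile s at d ⨾ compile t at (1 + d) ⨾
  register d := cons (var (register d)) (var (register (1 + d)))
compile (hd t) at d = compile t at d ⨾ register d := hd (var (register d))
compile (tl t) at d = compile t at d ⨾ register d := tl (var (register d))
compile (cond c s t) at d =
  compile c at d ⨾ if var (register d) then compile s at d else compile t at d
compile (fold xs z b) at d =
  -- Register `d` holds the accumulator, `1 + d` the remaining list, and `2 + d` a copy of the input
  -- that serves as a clock, shortened in every round.
  compile z at d ⨾ compile xs at (1 + d) ⨾ register (2 + d) := var zero ⨾
  foldLoop b at d

foldLoop b at d =
  while var (register (2 + d)) repeat
    (register (2 + d) := tl (var (register (2 + d))) ⨾
     if var (register (1 + d))
     then (register (3 + d) := hd (var (register (1 + d))) ⨾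
           register (1 + d) := tl (var (register (1 + d))) ⨾
           compile b ((3 + d) ∷ᵛ d ∷ᵛ at) (4 + d) ⨾
           register d := var (register (4 + d)))
     -- Once the list is exhausted the clock just runs down; a write to a scratch register stands
     -- for doing nothing.
     else (register (3 + d) := nil))

-- Space and polynomial time bounds for compiled terms

space : ∀ {k} → Term k → ℕ
space input         = 0
space (var i)       = 0
space nil           = 0
space (cons s t)    = space s ⊔ (1 + space t)
space (hd t)        = space t
space (tl t)        = space t
space (cond c s t)  = space c ⊔ (space s ⊔ space t)
-- The offsets are those at which the subterms are compiled, so register `d + space t` is the
-- highest one that `compile t at d` writes.
space (fold xs z b) = space z ⊔ ((1 + space xs) ⊔ (4 + space b))

-- The constants are the costs of the generated assignments and tests. A conditional adds both
-- branches, since a sum of polynomials is one, unlike a maximum. A round of a fold costs 15 besides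
-- its body: 2 + 2 for the two tests, 3 + 3 + 3 for taking heads and tails, 2 for the copy back.
bound : ∀ {k} → Term k → ℕ → ℕ
bound input         n = 2
bound (var i)       n = 2
bound nil           n = 2
bound (cons s t)    n = bound s n + (bound t n + 4)
bound (hd t)        n = bound t n + 3
bound (tl t)        n = bound t n + 3
bound (cond c s t)  n = bound c n + (2 + (bound s n + bound t n))
bound (fold xs z b) n =
  bound z n + (bound xs n + (2 + (suc n * (15 + bound b n) + 2)))

infixl 6 _⊕_
_⊕_ : Polynomial → Polynomial → Polynomial
[]      ⊕ q       = q
(c ∷ p) ⊕ []      = c ∷ p
(c ∷ p) ⊕ (d ∷ q) = (c + d) ∷ (p ⊕ q)

⊕-correct : ∀ p q n → ⟦ p ⊕ q ⟧ n ≡ ⟦ p ⟧ n + ⟦ q ⟧ n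
⊕-correct []      q       n = refl
⊕-correct (c ∷ p) []      n = sym (+-identityʳ _)
⊕-correct (c ∷ p) (d ∷ q) n rewrite ⊕-correct p q n =
  solve 5 (λ c d n p q → c :+ d :+ n :* (p :+ q) ⊜ c :+ n :* p :+ (d :+ n :* q))
    refl c d n (⟦ p ⟧ n) (⟦ q ⟧ n)
  where open +-*-Solver using (solve; _:+_; _:*_) renaming (_:=_ to _⊜_)

const : ℕ → Polynomial
const c = c ∷ []

poly : ∀ {k} → Term k → Polynomial
poly input         = const 2
poly (var i)       = const 2
poly nil           = const 2
poly (cons s t)    = poly s ⊕ (poly t ⊕ const 4)
poly (hd t)        = poly t ⊕ const 3
poly (tl t)        = poly t ⊕ const 3
poly (cond c s t)  = poly c ⊕ (const 2 ⊕ (poly s ⊕ poly t))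
poly (fold xs z b) =
  -- Prepending 0 multiplies by the variable, so `step ⊕ (0 ∷ step)` is `suc n` times `step`.
  poly z ⊕ (poly xs ⊕ (const 2 ⊕ ((step ⊕ (0 ∷ step)) ⊕ const 2)))
  where step = const 15 ⊕ poly b

-- A record instead of the bare equation, so that `p` can be inferred: `⟦ p ⟧ n` would unfold.
record Evaluates (p : Polynomial) (n a : ℕ) : Set where
  constructor evaluates
  field value : ⟦ p ⟧ n ≡ a

open Evaluates

⊕-evaluates : ∀ {p q n a b} → Evaluates p n a → Evaluates q n b → Evaluates (p ⊕ q) n (a + b)
⊕-evaluates {p} {q} {n} (evaluates e) (evaluates f) =
  evaluates (trans (⊕-correct p q n) (cong₂ _+_ e f))

const-evaluates : ∀ c {n} → Evaluates (const c) n c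
const-evaluates c {n} = evaluates (trans (cong (c +_) (*-zeroʳ n)) (+-identityʳ c))

X*-evaluates : ∀ {p n a} → Evaluates p n a → Evaluates (0 ∷ p) n (n * a)
X*-evaluates {n = n} (evaluates e) = evaluates (cong (n *_) e)

poly-correct : ∀ {k} (t : Term k) n → Evaluates (poly t) n (bound t n)
poly-correct input         n = const-evaluates 2
poly-correct (var i)       n = const-evaluates 2
poly-correct nil           n = const-evaluates 2
poly-correct (cons s t)    n =
  ⊕-evaluates (poly-correct s n) (⊕-evaluates (poly-correct t n) (const-evaluates 4))
poly-correct (hd t)        n = ⊕-evaluates (poly-correct t n) (const-evaluates 3)
poly-correct (tl t)        n = ⊕-evaluates (poly-correct t n) (const-evaluates 3)
poly-correct (cond c s t)  n =
  ⊕-evaluates (poly-correct c n)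
    (⊕-evaluates (const-evaluates 2) (⊕-evaluates (poly-correct s n) (poly-correct t n)))
poly-correct (fold xs z b) n =
  ⊕-evaluates (poly-correct z n)
    (⊕-evaluates (poly-correct xs n)
      (⊕-evaluates (const-evaluates 2)
        (⊕-evaluates (⊕-evaluates step (X*-evaluates step)) (const-evaluates 2))))
  where step = ⊕-evaluates (const-evaluates 15) (poly-correct b n)

-- Registers, frame conditions and time-bounded execution

get : ∀ {K} → Store (suc K) → ℕ → Tree
get σ d = lookup σ (register d)

set : ∀ {K} → Store (suc K) → ℕ → Tree → Store (suc K)
set σ d x = σ [ register d ≔ x ]

register-injective : ∀ {K d e} → d ≤ K → e ≤ K → register {K} d ≡ register e → d ≡ e
register-injective z≤n     z≤n     eq = refl
register-injective z≤n     (s≤s _) ()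
register-injective (s≤s _) z≤n     ()
register-injective (s≤s p) (s≤s q) eq = cong suc (register-injective p q (suc-injectiveᶠ eq))

get-set : ∀ {K} (σ : Store (suc K)) d x → get (set σ d x) d ≡ x
get-set σ d x = lookup∘update (register d) σ x

get-set-≢ : ∀ {K} {σ : Store (suc K)} {d e x} → d ≤ K → e ≤ K → e ≢ d →
            get (set σ d x) e ≡ get σ e
get-set-≢ {σ = σ} {x = x} d≤K e≤K e≢d =
  lookup∘update′ (λ eq → e≢d (register-injective e≤K d≤K eq)) σ x

infix 4 _≈[_]_
-- The frame condition: code compiled at `d` may use the registers from `d` on as scratch.
record _≈[_]_ {K} (σ : Store (suc K)) (d : ℕ) (τ : Store (suc K)) : Set where
  constructor agree
  field unchanged : ∀ e → e < d → get τ e ≡ get σ e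

open _≈[_]_

≈-trans : ∀ {K d} {ρ σ τ : Store (suc K)} → ρ ≈[ d ] σ → σ ≈[ d ] τ → ρ ≈[ d ] τ
≈-trans p q = agree λ e e<d → trans (unchanged q e e<d) (unchanged p e e<d)

≈-lower : ∀ {K c d} {σ τ : Store (suc K)} → c ≤ d → σ ≈[ d ] τ → σ ≈[ c ] τ
≈-lower c≤d p = agree λ e e<c → unchanged p e (≤-trans e<c c≤d)

≈-set : ∀ {K d} {σ : Store (suc K)} {x} → d ≤ K → σ ≈[ d ] set σ d x
≈-set {σ = σ} d≤K = agree λ e e<d → get-set-≢ {σ = σ} d≤K (≤-trans (<⇒≤ e<d) d≤K) (<⇒≢ e<d)

-- The input and the variables all live below `d`, so the frame condition at `d` preserves this
-- invariant; that is `keep`.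
record Scope {k K} (I : Tree) (at : Vec ℕ k) (d : ℕ) (ρ : Vec Tree k) (σ : Store (suc K)) : Set where
  field
    positive : 0 < d
    origin   : get σ 0 ≡ I
    below    : ∀ i → lookup at i < d
    agrees   : ∀ i → get σ (lookup at i) ≡ lookup ρ i

open Scope

module _ {k K : ℕ} {I : Tree} {at : Vec ℕ k} {ρ : Vec Tree k} where

  keep : ∀ {d} {σ τ : Store (suc K)} → σ ≈[ d ] τ → Scope I at d ρ σ → Scope I at d ρ τ
  keep p S = record
    { positive = positive S
    ; origin   = trans (unchanged p 0 (positive S)) (origin S)
    ; below    = below S
    ; agrees   = λ i → trans (unchanged p _ (below S i)) (agrees S i)
    }

  raise : ∀ {c d} {σ : Store (suc K)} → c ≤ d → Scope I at c ρ σ → Scope I at d ρ σ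
  raise c≤d S = record
    { positive = ≤-trans (positive S) c≤d
    ; origin   = origin S
    ; below    = λ i → ≤-trans (below S i) c≤d
    ; agrees   = agrees S
    }

  bind : ∀ {d e x} {σ : Store (suc K)} → e < d → get σ e ≡ x →
         Scope I at d ρ σ → Scope I (e ∷ᵛ at) d (x ∷ᵛ ρ) σ
  bind e<d eq S = record
    { positive = positive S
    ; origin   = origin S
    ; below    = λ { zero → e<d ; (suc i) → below S i }
    ; agrees   = λ { zero → eq ; (suc i) → agrees S i }
    }

-- The exact time depends on the data; only an upper bound can be computed from the term alone.
Within : ∀ {k} → Cmd k → Store k → Store k → ℕ → Set
Within C σ τ b = ∃ λ t → C ⊢ σ ⇓ τ ⟨ t ⟩ × t ≤ b

infixr 4 _then_
_then_ : ∀ {k} {C C′ : Cmd k} {ρ σ τ b b′} →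
         Within C ρ σ b → Within C′ σ τ b′ → Within (C ⨾ C′) ρ τ (b + b′)
(s , p , s≤b) then (t , q , t≤b′) = s + t , seq p q , +-mono-≤ s≤b t≤b′

now : ∀ {k x} {e : Expr k} {σ} → Within (x := e) σ (σ [ x ≔ eval e σ ]) (1 + cost e)
now = _ , assign , ≤-refl

relax : ∀ {k} {C : Cmd k} {σ τ b b′} → b ≤ b′ → Within C σ τ b → Within C σ τ b′
relax b≤b′ (t , p , t≤b) = t , p , ≤-trans t≤b b≤b′

Computes : ∀ {K} → Cmd (suc K) → ℕ → Store (suc K) → Tree → ℕ → Set
Computes C d σ x b = ∃ λ τ → Within C σ τ b × get τ d ≡ x × σ ≈[ d ] τ

set-result : ∀ {K d y b} {C : Cmd (suc K)} {σ τ : Store (suc K)} (e : Expr (suc K)) → d ≤ K →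
  σ ≈[ d ] τ → Within C σ τ b → eval e τ ≡ y →
  Computes (C ⨾ register d := e) d σ y (b + (1 + cost e))
set-result {d = d} {τ = τ} e d≤K σ≈τ w eq =
  _ , (w then now) , trans (get-set τ d _) eq , ≈-trans σ≈τ (≈-set d≤K)

+⇒≤ : ∀ {d c K} → d + c ≤ K → d ≤ K
+⇒≤ = ≤-trans (m≤m+n _ _)

+⊔⇒+ˡ : ∀ d a b {K} → d + (a ⊔ b) ≤ K → d + a ≤ K
+⊔⇒+ˡ d a b = ≤-trans (+-monoʳ-≤ d (m≤m⊔n a b))

+⊔⇒+ʳ : ∀ d a b {K} → d + (a ⊔ b) ≤ K → d + b ≤ K
+⊔⇒+ʳ d a b = ≤-trans (+-monoʳ-≤ d (m≤n⊔m a b))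

shift : ∀ d j {c K} → d + (j + c) ≤ K → (j + d) + c ≤ K
shift d j {c} {K} = subst (_≤ K) (trans (sym (+-assoc d j c)) (cong (_+ c) (+-comm d j)))

≡∙⇒≢nil : ∀ {s t u} → s ≡ t ∙ u → s ≢ nil
≡∙⇒≢nil refl ()

iterate : ∀ {k} {e : Expr k} {C ρ σ τ a b} → eval e ρ ≢ nil → Within C ρ σ a →
          Within (while e repeat C) σ τ b → Within (while e repeat C) ρ τ (1 + cost e + a + b)
iterate {e = e} ≢nil (s , p , s≤a) (t , q , t≤b) =
  _ , loop ≢nil p q , +-mono-≤ (+-monoʳ-≤ (1 + cost e) s≤a) t≤b

-- Soundness and running time of the compiled code

module _ {K n : ℕ} {I : Tree} (clock : spine I ≡ suc n) where

  -- Induction on the term. The frame condition in `Computes` is what lets a value already computed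
  -- survive the evaluation of the next subterm.
  sound : ∀ {k} (t : Term k) {at d ρ} {σ : Store (suc K)} → d + space t ≤ K →
          Scope I at d ρ σ → Computes (compile t at d) d σ (den I t ρ) (bound t n)

  -- Induction on the clock `c`, not on the list: every round uses up one node of the clock, also
  -- when the list is empty.
  loop-sound : ∀ {k} (b : Term (2 + k)) {at d ρ} {σ : Store (suc K)} c xs acc →
    (4 + d) + space b ≤ K → Scope I at d ρ σ →
    get σ d ≡ acc → get σ (1 + d) ≡ xs → get σ (2 + d) ≡ c →
    Computes (foldLoop b at d) d σ
      (walk c (λ x acc → den I b (x ∷ᵛ acc ∷ᵛ ρ)) xs acc)
      (spine c * (15 + bound b n) + 2)

  sound input   {d = d} {σ = σ} fit S =
    _ , now , trans (get-set σ d _) (origin S) , ≈-set (+⇒≤ fit)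
  sound (var i) {d = d} {σ = σ} fit S =
    _ , now , trans (get-set σ d _) (agrees S i) , ≈-set (+⇒≤ fit)
  sound nil     {d = d} {σ = σ} fit S =
    _ , now , get-set σ d _ , ≈-set (+⇒≤ fit)
  sound (cons s t) {d = d} fit S =
    let σ₁ , w₁ , e₁ , p₁ = sound s (+⊔⇒+ˡ d (space s) (1 + space t) fit) S
        σ₂ , w₂ , e₂ , p₂ = sound t (shift d 1 (+⊔⇒+ʳ d (space s) _ fit))
          (raise (n≤1+n d) (keep p₁ S))
    in _ , (w₁ then w₂ then now) ,
       trans (get-set σ₂ d _) (cong₂ _∙_ (trans (unchanged p₂ d ≤-refl) e₁) e₂) ,
       ≈-trans p₁ (≈-trans (≈-lower (n≤1+n d) p₂) (≈-set (+⇒≤ fit)))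
  sound (hd t) fit S =
    let τ , w , e , p = sound t fit S in set-result (hd (var _)) (+⇒≤ fit) p w (cong left e)
  sound (tl t) fit S =
    let τ , w , e , p = sound t fit S in set-result (tl (var _)) (+⇒≤ fit) p w (cong right e)
  sound (cond c s t) {d = d} {ρ} fit S
    with σ₁ , w₁ , e₁ , p₁ ← sound c (+⊔⇒+ˡ d (space c) _ fit) S
    -- By `e₁` this value is also the content of the tested register, so one case split settles both
    -- the denotation and the branch taken.
    with den I c ρ
  ... | nil =
    let σ₂ , (_ , r , r≤) , e₂ , p₂ =
          sound t (+⊔⇒+ʳ d (space s) _ (+⊔⇒+ʳ d (space c) _ fit)) (keep p₁ S)
    in σ₂ , (w₁ then (_ , if-no e₁ r , +-monoʳ-≤ 2 (≤-trans r≤ (m≤n+m _ _)))) ,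
       e₂ , ≈-trans p₁ p₂
  ... | _ ∙ _ =
    let σ₂ , (_ , r , r≤) , e₂ , p₂ =
          sound s (+⊔⇒+ˡ d (space s) _ (+⊔⇒+ʳ d (space c) _ fit)) (keep p₁ S)
    in σ₂ , (w₁ then (_ , if-yes (≡∙⇒≢nil e₁) r , +-monoʳ-≤ 2 (≤-trans r≤ (m≤m+n _ _)))) ,
       e₂ , ≈-trans p₁ p₂
  sound (fold xs z b) {at} {d} {ρ} fit S =
    let loop-fit = +⊔⇒+ʳ d (space z) ((1 + space xs) ⊔ (4 + space b)) fit
        body-fit = shift d 4 (+⊔⇒+ʳ d (1 + space xs) (4 + space b) loop-fit)
        2+d≤K = ≤-trans (m≤n+m (2 + d) 2) (+⇒≤ body-fit)
        σ₁ , w₁ , e₁ , p₁ = sound z (+⊔⇒+ˡ d (space z) _ fit) S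
        σ₂ , w₂ , e₂ , p₂ =
          sound xs (shift d 1 (+⊔⇒+ˡ d (1 + space xs) (4 + space b) loop-fit))
            (raise (n≤1+n d) (keep p₁ S))
        p₁₂ = ≈-trans p₁ (≈-lower (n≤1+n d) p₂)
        q = ≈-set {x = get σ₂ 0} 2+d≤K
        p₃ = ≈-trans p₁₂ (≈-lower (m≤n+m d 2) q)
        σ₄ , w₄ , e₄ , p₄ =
          loop-sound b I _ _ body-fit (keep p₃ S)
            (trans (unchanged q d (m≤n+m _ 1)) (trans (unchanged p₂ d ≤-refl) e₁))
            (trans (unchanged q (1 + d) ≤-refl) e₂)
            (trans (get-set σ₂ (2 + d) _) (origin (keep p₁₂ S)))
    in σ₄ ,
       (w₁ then w₂ then now then
        relax (≤-reflexive (cong (λ m → m * (15 + bound b n) + 2) clock)) w₄) ,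
       e₄ , ≈-trans p₃ p₄

  loop-sound b nil xs acc fit S e-acc e-xs e-c =
    _ , (_ , exit e-c , ≤-refl) , e-acc , agree λ _ _ → refl
  loop-sound b {d = d} {σ = σ} (_ ∙ c) nil acc fit S e-acc e-xs e-c =
    let 3+d≤K = ≤-trans (m≤n+m (3 + d) 1) (+⇒≤ fit)
        σ₁ = set σ (2 + d) (right (get σ (2 + d)))
        p₁ = ≈-set {σ = σ} {x = right (get σ (2 + d))} (≤-trans (n≤1+n _) 3+d≤K)
        p₂ = ≈-set {σ = σ₁} {x = nil} 3+d≤K
        p = ≈-trans p₁ (≈-lower (n≤1+n (2 + d)) p₂)
        τ , w , e , q =
          loop-sound b c nil acc fit (keep (≈-lower (m≤n+m d 2) p) S)
            (trans (unchanged p d (m≤n+m _ 1)) e-acc)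
            (trans (unchanged p (1 + d) ≤-refl) e-xs)
            (trans (unchanged p₂ (2 + d) ≤-refl) (trans (get-set σ (2 + d) _) (cong right e-c)))
        body = now then (_ , if-no (trans (unchanged p₁ (1 + d) ≤-refl) e-xs) assign , ≤-refl)
    in τ ,
       relax (≤-reflexive (sym (+-assoc (15 + bound b n) _ 2)))
         -- An idle round costs 3 + 2 + 2 = 7 inside the loop; the budget there is 13 + `bound b n`,
         -- the loop test taking the other 2 of the 15.
         (iterate (≡∙⇒≢nil e-c) (relax (m≤m+n 7 (6 + bound b n)) body) w) ,
       e , ≈-trans (≈-lower (m≤n+m d 2) p) q
  loop-sound b {d = d} {σ = σ} (_ ∙ c) (x ∙ xs) acc fit S e-acc e-xs e-c =
    let 4+d≤K = +⇒≤ fit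
        3+d≤K = ≤-trans (m≤n+m (3 + d) 1) 4+d≤K
        2+d≤K = ≤-trans (m≤n+m (2 + d) 1) 3+d≤K
        1+d≤K = ≤-trans (m≤n+m (1 + d) 1) 2+d≤K
        d≤K = ≤-trans (n≤1+n d) 1+d≤K
        σ₁ = set σ (2 + d) (right (get σ (2 + d)))
        p₁ = ≈-set {σ = σ} {x = right (get σ (2 + d))} 2+d≤K
        e-xs₁ = trans (unchanged p₁ (1 + d) ≤-refl) e-xs
        e-c₁ = trans (get-set σ (2 + d) _) (cong right e-c)
        σ₂ = set σ₁ (3 + d) (left (get σ₁ (1 + d)))
        p₂ = ≈-set {σ = σ₁} {x = left (get σ₁ (1 + d))} 3+d≤K
        e-x₂ = trans (get-set σ₁ (3 + d) _) (cong left e-xs₁)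
        e-xs₂ = trans (unchanged p₂ (1 + d) (n≤1+n _)) e-xs₁
        σ₃ = set σ₂ (1 + d) (right (get σ₂ (1 + d)))
        p₃ = ≈-set {σ = σ₂} {x = right (get σ₂ (1 + d))} 1+d≤K
        e-x₃ = trans (get-set-≢ {σ = σ₂} 1+d≤K 3+d≤K (λ ())) e-x₂
        e-xs₃ = trans (get-set σ₂ (1 + d) _) (cong right e-xs₂)
        e-c₃ = trans (get-set-≢ {σ = σ₂} 1+d≤K 2+d≤K (λ ()))
                 (trans (unchanged p₂ (2 + d) ≤-refl) e-c₁)
        p₁₂₃ = ≈-trans (≈-lower (n≤1+n (1 + d)) p₁) (≈-trans (≈-lower (m≤n+m (1 + d) 2) p₂) p₃)
        p = ≈-lower (n≤1+n d) p₁₂₃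
        S₃ = keep p S
        -- The body is compiled at `4 + d`, above the accumulator, list, clock and element, so `p₄`
        -- protects all four while it runs.
        σ₄ , w₄ , e₄ , p₄ =
          sound b fit
            (bind ≤-refl e-x₃
              (bind (m≤n+m (1 + d) 3) (trans (unchanged p₁₂₃ d ≤-refl) e-acc) (raise (m≤n+m d 4) S₃)))
        p₅ = ≈-set {σ = σ₄} {x = get σ₄ (4 + d)} d≤K
        p′ = ≈-trans p (≈-trans (≈-lower (m≤n+m d 4) p₄) p₅)
        τ , w , e , q =
          loop-sound b c xs _ fit (keep p′ S)
            (trans (get-set σ₄ d _) e₄)
            (trans (get-set-≢ {σ = σ₄} d≤K 1+d≤K (λ ())) (trans (unchanged p₄ (1 + d) (m≤n+m _ 2)) e-xs₃))
            (trans (get-set-≢ {σ = σ₄} d≤K 2+d≤K (λ ())) (trans (unchanged p₄ (2 + d) (m≤n+m _ 1)) e-c₃))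
        _ , r , r≤ = now then now then w₄ then now
        body = now then (_ , if-yes (≡∙⇒≢nil e-xs₁) r , +-monoʳ-≤ 2 r≤)
    in τ ,
       relax (≤-reflexive (sym (+-assoc (15 + bound b n) _ 2)))
         -- Before the body come 3 + 2 + 3 + 3 = 11 units, after it 2 for the copy; a full round
         -- meets the budget exactly.
         (iterate (≡∙⇒≢nil e-c) (relax (≤-reflexive (cong (11 +_) (+-comm (bound b n) 2))) body) w) ,
       e , ≈-trans p′ q

-- Programs from closed terms

head≡lookup : ∀ {k} (σ : Store (suc k)) → head σ ≡ lookup σ zero
head≡lookup (_ ∷ᵛ _) = refl

-- Register 0 must keep the input while the term runs, since every fold copies its clock from there;
-- the result is therefore built in register 1 and moved at the end.
termProgram : Term 0 → Program
termProgram t =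
  program {1 + space t} (compile t []ᵛ 1 ⨾ zero := var (register 1))

termProgram-runs : ∀ (t : Term 0) {n I} → spine I ≡ suc n →
  ∃ λ time → Runs (termProgram t) I (den I t []ᵛ) time × time ≤ ⟦ poly t ⊕ const 2 ⟧ n
termProgram-runs t {n} clock =
  let σ₁ , w₁ , e₁ , p₁ = sound clock t ≤-refl
        (record { positive = s≤s z≤n ; origin = refl ; below = λ () ; agrees = λ () })
      time , run , time≤ = w₁ then now
  in time ,
     (_ , run , trans (head≡lookup (set σ₁ 0 (get σ₁ 1))) (trans (get-set σ₁ 0 _) e₁)) ,
     ≤-trans time≤ (≤-reflexive (sym (value (⊕-evaluates (poly-correct t n) (const-evaluates 2)))))

-- The transformation as a term

walk-nil : ∀ c f acc → walk c f nil acc ≡ acc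
walk-nil nil     f acc = refl
walk-nil (_ ∙ c) f acc = walk-nil c f acc

walk-list : ∀ c f ts acc → length ts ≤ spine c →
            walk c f ⌜ ts ⌝ˡ acc ≡ foldl (λ acc t → f t acc) acc ts
walk-list c       f []       acc _         = walk-nil c f acc
walk-list (_ ∙ c) f (t ∷ ts) acc (s≤s len) = walk-list c f ts (f t acc) len

-- `walk` is a left fold, and the lists it runs over are descending. Read as reversed ascending
-- lists, they give right folds, which build lists in the original order.
walk-reverse : ∀ {A : Set} (enc : A → Tree) c f xs z → length xs ≤ spine c →
               walk c f ⌜ map enc (reverse xs) ⌝ˡ z ≡ foldr (λ x acc → f (enc x) acc) z xs
walk-reverse enc c f xs z len = begin
  walk c f ⌜ map enc (reverse xs) ⌝ˡ z
    ≡⟨ cong (λ ts → walk c f ⌜ ts ⌝ˡ z) (reverse-map enc xs) ⟩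
  walk c f ⌜ reverse (map enc xs) ⌝ˡ z
    ≡⟨ walk-list c f (reverse (map enc xs)) z len′ ⟩
  foldl (λ acc t → f t acc) z (reverse (map enc xs))
    ≡⟨ reverse-foldl (λ acc t → f t acc) z (map enc xs) ⟩
  foldr f z (map enc xs)
    ≡⟨ foldr-map f enc z xs ⟩
  foldr (λ x acc → f (enc x) acc) z xs ∎
  where
  open ≡-Reasoning
  len′ = ≤-trans (≤-reflexive (trans (length-reverse (map enc xs)) (length-map enc xs))) len

-- On numerals this is truncated subtraction and on lists it drops entries, so comparison and matrix
-- lookup share it.
strip : ℕ → Tree → Tree
strip zero    t = t
strip (suc m) t = strip m (right t)

walk-strip : ∀ c m t → m ≤ spine c → walk c (λ _ acc → right acc) ⌜ m ⌝ⁿ t ≡ strip m t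
walk-strip c       zero    t _       = walk-nil c _ t
walk-strip (_ ∙ c) (suc m) t (s≤s p) = walk-strip c m (right t) p

strip-⌜⌝ⁿ : ∀ m k → strip m ⌜ k ⌝ⁿ ≡ ⌜ k ∸ m ⌝ⁿ
strip-⌜⌝ⁿ zero    k       = refl
strip-⌜⌝ⁿ (suc m) zero    = trans (strip-⌜⌝ⁿ m zero) (cong ⌜_⌝ⁿ (0∸n≡0 m))
strip-⌜⌝ⁿ (suc m) (suc k) = strip-⌜⌝ⁿ m k

strip-tabulate : ∀ {n} (f : Fin n → Tree) i → left (strip (toℕ i) ⌜ tabulate f ⌝ˡ) ≡ f i
strip-tabulate f zero    = refl
strip-tabulate f (suc i) = strip-tabulate (f ∘ suc) i

spine-list : ∀ ts → spine ⌜ ts ⌝ˡ ≡ length ts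
spine-list []       = refl
spine-list (t ∷ ts) = cong suc (spine-list ts)

-- Nested loops pass one accumulator along, so they amount to a single loop over the product.
foldr-product : ∀ {A B C : Set} (f : A × B → C → C) z xs ys →
  foldr (λ x acc → foldr (λ y → f (x , y)) acc ys) z xs ≡ foldr f z (cartesianProduct xs ys)
foldr-product f z []       ys = refl
foldr-product f z (x ∷ xs) ys = begin
  foldr (λ y → f (x , y)) (foldr _ z xs) ys
    ≡⟨ cong (λ acc → foldr (λ y → f (x , y)) acc ys) (foldr-product f z xs ys) ⟩
  foldr (λ y → f (x , y)) (foldr f z (cartesianProduct xs ys)) ys
    ≡⟨ foldr-map f (x ,_) _ ys ⟨
  foldr f (foldr f z (cartesianProduct xs ys)) (map (x ,_) ys)
    ≡⟨ foldr-++ f z (map (x ,_) ys) (cartesianProduct xs ys) ⟨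
  foldr f z (cartesianProduct (x ∷ xs) ys) ∎
  where open ≡-Reasoning

foldr-filter : ∀ {A : Set} {P : Pred A 0ℓ} (P? : Decidable P) (enc : A → Tree) xs →
  foldr (λ x acc → Bool.if does (P? x) then enc x ∙ acc else acc) nil xs ≡ ⌜ map enc (filter P? xs) ⌝ˡ
foldr-filter P? enc []       = refl
foldr-filter P? enc (x ∷ xs) with does (P? x)
... | true  = cong (enc x ∙_) (foldr-filter P? enc xs)
... | false = foldr-filter P? enc xs

-- Indexed by `Fin m`, so that a loop variable is at once a vertex or a stage; `numerals≡downFrom`
-- gives the form in which heads and tails are visible.
numerals : ℕ → Tree
numerals m = ⌜ map (λ i → ⌜ toℕ i ⌝ⁿ) (reverse (allFin m)) ⌝ˡ

map-toℕ-allFin : ∀ m → map toℕ (allFin m) ≡ upTo m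
map-toℕ-allFin m = trans (map-tabulate id toℕ) (go m id)
  where
  go : ∀ {A : Set} m (f : ℕ → A) → tabulate {n = m} (f ∘ toℕ) ≡ applyUpTo f m
  go zero    f = refl
  go (suc m) f = cong (f 0 ∷_) (go m (f ∘ suc))

numerals≡downFrom : ∀ m → numerals m ≡ ⌜ map ⌜_⌝ⁿ (downFrom m) ⌝ˡ
numerals≡downFrom m = cong ⌜_⌝ˡ (begin
  map (⌜_⌝ⁿ ∘ toℕ) (reverse (allFin m))   ≡⟨ map-∘ (reverse (allFin m)) ⟩
  map ⌜_⌝ⁿ (map toℕ (reverse (allFin m))) ≡⟨ cong (map ⌜_⌝ⁿ) (reverse-map toℕ (allFin m)) ⟩
  map ⌜_⌝ⁿ (reverse (map toℕ (allFin m))) ≡⟨ cong (map ⌜_⌝ⁿ ∘ reverse) (map-toℕ-allFin m) ⟩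
  map ⌜_⌝ⁿ (reverse (upTo m))             ≡⟨ cong (map ⌜_⌝ⁿ) (reverse-upTo m) ⟩
  map ⌜_⌝ⁿ (downFrom m)                   ∎)
  where open ≡-Reasoning

-- The clock doubles as the list, so each of its nodes triggers one step, which prepends the
-- successor of the current head.
walk-count : ∀ c m →
  walk c (λ _ acc → (nil ∙ left acc) ∙ acc) c ⌜ map ⌜_⌝ⁿ (downFrom (suc m)) ⌝ˡ
    ≡ ⌜ map ⌜_⌝ⁿ (downFrom (suc (spine c + m))) ⌝ˡ
walk-count nil     m = refl
walk-count (_ ∙ c) m = trans (walk-count c (suc m))
  (cong (λ k → ⌜ map ⌜_⌝ⁿ (downFrom (suc k)) ⌝ˡ) (+-suc (spine c) m))

-- Terms for numbers, tests and nested loops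

module _ {k : ℕ} where

  -- Serves both as the truth value and as the list with the single entry 0 from which `countdown`
  -- starts.
  one : Term k
  one = cons nil nil

  -- The numbers n + 1, …, 0 when the input has spine n + 1.
  countdown stages vertices order start : Term k
  countdown = fold input one (cons (cons nil (hd (var 1F))) (var 1F))
  -- The spine of the input also counts the numeral of `v`, so `countdown` begins at n + 1; its
  -- tails are the stages n, ..., 0 and the vertices n - 1, ..., 0.
  stages    = tl countdown
  vertices  = tl stages
  order     = hd stages
  start     = hd input

  notᵗ : Term k → Term k
  notᵗ c = cond c nil one

  infixr 6 _∧ᵗ_
  infixr 5 _∨ᵗ_
  infixr 4 _⇒ᵗ_
  infix  7 _<ᵗ_ _≡ᵗ_

  _∧ᵗ_ _∨ᵗ_ _⇒ᵗ_ _<ᵗ_ _≡ᵗ_ stripᵗ : Term k → Term k → Term k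
  c ∧ᵗ d = cond c d nil
  c ∨ᵗ d = cond c one d
  c ⇒ᵗ d = cond c d one
  stripᵗ s t = fold s t (tl (var 1F))
  -- The truncated difference `t ∸ s` is nonzero exactly when `s < t`, and nonzero numerals are
  -- true.
  s <ᵗ t = stripᵗ s t
  s ≡ᵗ t = notᵗ (s <ᵗ t) ∧ᵗ notᵗ (t <ᵗ s)

  adjacentᵗ okᵗ : Term k → Term k → Term k
  adjacentᵗ a b = hd (stripᵗ b (hd (stripᵗ a (tl input))))
  okᵗ x i = (x ≡ᵗ start ⇒ᵗ boundary) ∧ᵗ (boundary ⇒ᵗ x ≡ᵗ start)
    where boundary = notᵗ i ∨ᵗ i ≡ᵗ order

  emit : Term (2 + k) → Term (2 + k) → Term (2 + k)
  emit c e = cond c (cons e (var 1F)) (var 1F)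

-- The bodies c and e refer to the elements of the enclosing folds by the even
-- variables; the odd ones are accumulators.

pairsᵗ : ∀ {k} → Term (4 + k) → Term (4 + k) → Term k
pairsᵗ c e = fold stages nil (fold vertices (var 1F) (emit c e))

triplesᵗ : ∀ {k} → Term (6 + k) → Term (6 + k) → Term k
triplesᵗ c e = fold vertices nil (fold vertices (var 1F) (fold vertices (var 1F) (emit c e)))

edgeᵗ : ∀ {k} → Term (6 + k)
edgeᵗ = cons (cons (var 2F) (var 4F)) (cons (cons (var 0F) (cons nil (var 4F))) (cons nil (var 4F)))

allowedᵗ : ∀ {k} → Term (6 + k) → Term (6 + k) → Term (6 + k)
allowedᵗ u l =
  adjacentᵗ a b ∧ᵗ okᵗ a j ∧ᵗ okᵗ b (cons nil j) ∧ᵗ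
  -- The edge must not meet `(u , k)` with 0 < k < l, either at its source, of stage `j`, or at its
  -- target, whose stage `j + 1` is positive anyway.
  notᵗ (a ≡ᵗ u ∧ᵗ j ∧ᵗ j <ᵗ l) ∧ᵗ notᵗ (b ≡ᵗ u ∧ᵗ cons nil j <ᵗ l)
  where
  b = var 0F
  a = var 2F
  j = var 4F

-- For l = 0 nothing is excluded, so that this also lists all edges of G′.

edgesᵗ : ∀ {k} → Term (6 + k) → Term (6 + k) → Term k
edgesᵗ u l = triplesᵗ (allowedᵗ u l) edgeᵗ

entryᵗ : Term 4
-- Three further folds bind two variables each, so the vertex and its stage move from 0 and 2 to 6
-- and 8.
entryᵗ = cons (cons (var 0F) (var 2F)) (edgesᵗ (var 6F) (var 8F))

stagedᵗ labelsᵗ : Term 0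
stagedᵗ = pairsᵗ (okᵗ (var 0F) (var 2F)) (cons (var 2F) (cons (var 0F) (var 2F)))
labelsᵗ =
  -- The stage itself is the first test: stage 0, that is `S`, carries no label.
  pairsᵗ (var 2F ∧ᵗ okᵗ (var 0F) (var 2F))
         entryᵗ

transform : Term 0
transform =
  cons order (cons (cons start nil) (cons (cons start order)
    (cons stagedᵗ (cons (edgesᵗ start nil) labelsᵗ))))

-- What the terms denote on an encoded graph

truthy-⌜⌝ⁿ : ∀ m → Reflects (m ≢ 0) (truthy ⌜ m ⌝ⁿ)
truthy-⌜⌝ⁿ zero    = ofⁿ λ ≢ → ≢ refl
truthy-⌜⌝ⁿ (suc m) = ofʸ λ ()

truthy-⌜⌝ᵇ : ∀ b → Reflects (T b) (truthy ⌜ b ⌝ᵇ)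
truthy-⌜⌝ᵇ true  = ofʸ _
truthy-⌜⌝ᵇ false = ofⁿ id

map-reflects : ∀ {P Q : Set} {b} → (P → Q) → (Q → P) → Reflects P b → Reflects Q b
map-reflects f g (ofʸ p)  = ofʸ (f p)
map-reflects f g (ofⁿ ¬p) = ofⁿ (¬p ∘ g)

-- All connectives are instances of `cond`, so this one rule yields their reflection lemmas.
if-reflects : ∀ {P Q : Set} c {s t} → Reflects P (truthy c) →
              (P → Reflects Q (truthy s)) → (¬ P → Reflects Q (truthy t)) →
              Reflects Q (truthy (Bool.if truthy c then s else t))
if-reflects nil     (ofⁿ ¬p) f g = g ¬p
if-reflects (_ ∙ _) (ofʸ p)  f g = f p

-- (x , i) is admissible: for i ≤ n, it is a vertex of G′.

Ok : ∀ {n} → Fin n → Fin n → ℕ → Set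
Ok {n} v x i = (x ≡ v → i ≡ 0 ⊎ i ≡ n) × (i ≡ 0 ⊎ i ≡ n → x ≡ v)

ok? : ∀ {n} (v x : Fin n) i → Dec (Ok v x i)
ok? {n} v x i = (x ≟ᶠ v →-dec boundary?) ×-dec (boundary? →-dec x ≟ᶠ v)
  where boundary? = (i ≟ 0) ⊎-dec (i ≟ n)

module Denotation {n : ℕ} (G : Graph n) (v : Fin n) where

  open Graph G

  I : Tree
  I = encodeInput G v

  row : Fin n → Tree
  row a = ⌜ tabulate (λ b → ⌜ adjacent a b ⌝ᵇ) ⌝ˡ

  clock : spine I ≡ suc n
  clock = cong suc (trans (spine-list (tabulate row)) (length-tabulate row))

  record Holds {k} (ρ : Vec Tree k) (c : Term k) (P : Set) : Set where
    constructor holds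
    field reflects : Reflects P (truthy (den I c ρ))

  -- The bound guarantees that a fold over the numeral is not cut off by the clock, hence that
  -- `stripᵗ` strips all `m` times.
  record Number {k} (ρ : Vec Tree k) (t : Term k) (m : ℕ) : Set where
    constructor _#≤_
    field
      denotes : den I t ρ ≡ ⌜ m ⌝ⁿ
      bounded : m ≤ suc n

  toℕ≤1+n : (x : Fin n) → toℕ x ≤ suc n
  toℕ≤1+n x = ≤-trans (toℕ≤n x) (n≤1+n n)

  module _ {k : ℕ} {ρ : Vec Tree k} where

    den-countdown : den I countdown ρ ≡ numerals (suc (suc n))
    den-countdown = begin
      den I countdown ρ                             ≡⟨ walk-count I 0 ⟩
      ⌜ map ⌜_⌝ⁿ (downFrom (suc (spine I + 0))) ⌝ˡ
        ≡⟨ cong (λ m → ⌜ map ⌜_⌝ⁿ (downFrom (suc m)) ⌝ˡ) (trans (+-identityʳ _) clock) ⟩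
      ⌜ map ⌜_⌝ⁿ (downFrom (suc (suc n))) ⌝ˡ        ≡⟨ numerals≡downFrom (suc (suc n)) ⟨
      numerals (suc (suc n)) ∎
      where open ≡-Reasoning

    right-numerals : ∀ m → right (numerals (suc m)) ≡ numerals m
    right-numerals m = trans (cong right (numerals≡downFrom (suc m))) (sym (numerals≡downFrom m))

    den-stages : den I stages ρ ≡ numerals (suc n)
    den-stages = trans (cong right den-countdown) (right-numerals (suc n))

    den-vertices : den I vertices ρ ≡ numerals n
    den-vertices = trans (cong right den-stages) (right-numerals n)

    den-order : den I order ρ ≡ ⌜ n ⌝ⁿ
    den-order = cong left (trans den-stages (numerals≡downFrom (suc n)))

    not-holds : ∀ {c P} → Holds ρ c P → Holds ρ (notᵗ c) (¬ P)
    not-holds {c} (holds r) = holds (if-reflects (den I c ρ) r (λ p → ofⁿ λ ¬p → ¬p p) ofʸ)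

    ∧-holds : ∀ {c d P Q} → Holds ρ c P → Holds ρ d Q → Holds ρ (c ∧ᵗ d) (P × Q)
    ∧-holds {c} (holds r) (holds s) =
      holds (if-reflects (den I c ρ) r (λ p → map-reflects (p ,_) proj₂ s) (λ ¬p → ofⁿ (¬p ∘ proj₁)))

    ∨-holds : ∀ {c d P Q} → Holds ρ c P → Holds ρ d Q → Holds ρ (c ∨ᵗ d) (P ⊎ Q)
    ∨-holds {c} (holds r) (holds s) =
      holds (if-reflects (den I c ρ) r (ofʸ ∘ inj₁)
        (λ ¬p → map-reflects inj₂ (λ { (inj₁ p) → contradiction p ¬p ; (inj₂ q) → q }) s))

    ⇒-holds : ∀ {c d P Q} → Holds ρ c P → Holds ρ d Q → Holds ρ (c ⇒ᵗ d) (P → Q)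
    ⇒-holds {c} (holds r) (holds s) =
      holds (if-reflects (den I c ρ) r (λ p → map-reflects (λ q _ → q) (λ f → f p) s)
        (λ ¬p → ofʸ λ p → contradiction p ¬p))

    map-holds : ∀ {c P Q} → (P → Q) → (Q → P) → Holds ρ c P → Holds ρ c Q
    map-holds f g (holds r) = holds (map-reflects f g r)

    nonzero-holds : ∀ {t m} → Number ρ t m → Holds ρ t (m ≢ 0)
    nonzero-holds {m = m} (eq #≤ _) =
      holds (subst (λ x → Reflects (m ≢ 0) (truthy x)) (sym eq) (truthy-⌜⌝ⁿ m))

    positive-holds : ∀ {t m} → Number ρ t m → Holds ρ t (0 < m)
    positive-holds num = map-holds n≢0⇒n>0 m<n⇒n≢0 (nonzero-holds num)

    zero-holds : ∀ {t m} → Number ρ t m → Holds ρ (notᵗ t) (m ≡ 0)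
    zero-holds num =
      map-holds (λ ≯0 → n≤0⇒n≡0 (≮⇒≥ ≯0)) (λ { refl () }) (not-holds (positive-holds num))

    den-strip : ∀ {s m} → Number ρ s m → ∀ t → den I (stripᵗ s t) ρ ≡ strip m (den I t ρ)
    den-strip {m = m} (eq #≤ m≤) t =
      trans (cong (λ c → walk I _ c (den I t ρ)) eq)
        (walk-strip I m (den I t ρ) (≤-trans m≤ (≤-reflexive (sym clock))))

    <-holds : ∀ {s t m p} → Number ρ s m → Number ρ t p → Holds ρ (s <ᵗ t) (m < p)
    <-holds {s} {t} {m} {p} num (eq #≤ _) =
      holds (subst (λ x → Reflects (m < p) (truthy x)) (sym den-<)
        (map-reflects (λ ≢0 → ≰⇒> (≢0 ∘ m≤n⇒m∸n≡0)) m>n⇒m∸n≢0 (truthy-⌜⌝ⁿ (p ∸ m))))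
      where
      den-< : den I (s <ᵗ t) ρ ≡ ⌜ p ∸ m ⌝ⁿ
      den-< = trans (den-strip num t) (trans (cong (strip m) eq) (strip-⌜⌝ⁿ m p))

    ≡-holds : ∀ {s t m p} → Number ρ s m → Number ρ t p → Holds ρ (s ≡ᵗ t) (m ≡ p)
    ≡-holds num num′ =
      map-holds (λ (≮ , ≯) → ≤-antisym (≮⇒≥ ≯) (≮⇒≥ ≮)) (λ { refl → <-irrefl refl , <-irrefl refl })
        (∧-holds (not-holds (<-holds num num′)) (not-holds (<-holds num′ num)))

    ≡ᶠ-holds : ∀ {s t} {x y : Fin n} → Number ρ s (toℕ x) → Number ρ t (toℕ y) → Holds ρ (s ≡ᵗ t) (x ≡ y)
    ≡ᶠ-holds p q = map-holds toℕ-injective (cong toℕ) (≡-holds p q)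

    adjacent-holds : ∀ {s t a b} → Number ρ s (toℕ a) → Number ρ t (toℕ b) →
                     Holds ρ (adjacentᵗ s t) (Adj a b)
    adjacent-holds {s} {t} {a} {b} p q =
      holds (subst (λ x → Reflects (Adj a b) (truthy x)) (sym den-adjacent) (truthy-⌜⌝ᵇ (adjacent a b)))
      where
      open ≡-Reasoning
      den-adjacent : den I (adjacentᵗ s t) ρ ≡ ⌜ adjacent a b ⌝ᵇ
      den-adjacent = begin
        den I (adjacentᵗ s t) ρ
          ≡⟨ cong left (den-strip q (hd (stripᵗ s (tl input)))) ⟩
        left (strip (toℕ b) (left (den I (stripᵗ s (tl input)) ρ)))
          ≡⟨ cong (λ r → left (strip (toℕ b) (left r))) (den-strip p (tl input)) ⟩
        left (strip (toℕ b) (left (strip (toℕ a) (right I))))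
          ≡⟨ cong (λ r → left (strip (toℕ b) r)) (strip-tabulate row a) ⟩
        left (strip (toℕ b) (row a))
          ≡⟨ strip-tabulate (λ b → ⌜ adjacent a b ⌝ᵇ) b ⟩
        ⌜ adjacent a b ⌝ᵇ ∎

    order-number : Number ρ order n
    order-number = den-order #≤ n≤1+n n

    start-number : Number ρ start (toℕ v)
    start-number = refl #≤ toℕ≤1+n v

    ok-holds : ∀ {s t x i} → Number ρ s (toℕ x) → Number ρ t i → Holds ρ (okᵗ s t) (Ok v x i)
    ok-holds p q = ∧-holds (⇒-holds at-start boundary) (⇒-holds boundary at-start)
      where
      at-start = ≡ᶠ-holds p start-number
      boundary = ∨-holds (zero-holds q) (≡-holds q order-number)

  den-fold : ∀ {k} {ρ : Vec Tree k} {m} xs z b → m ≤ suc n → den I xs ρ ≡ numerals m →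
    den I (fold xs z b) ρ ≡
    foldr (λ i acc → den I b (⌜ toℕ i ⌝ⁿ ∷ᵛ acc ∷ᵛ ρ)) (den I z ρ) (allFin m)
  den-fold {ρ = ρ} {m} xs z b m≤ eq = trans
    (cong (λ ts → walk I (λ x acc → den I b (x ∷ᵛ acc ∷ᵛ ρ)) ts (den I z ρ)) eq)
    (walk-reverse _ I _ (allFin m) _
      (≤-trans (≤-reflexive (length-tabulate id)) (≤-trans m≤ (≤-reflexive (sym clock)))))

  den-fold-stages : ∀ {k} (ρ : Vec Tree k) z b →
    den I (fold stages z b) ρ ≡
    foldr (λ i acc → den I b (⌜ toℕ i ⌝ⁿ ∷ᵛ acc ∷ᵛ ρ)) (den I z ρ) (allFin (suc n))
  den-fold-stages ρ z b = den-fold stages z b ≤-refl (den-stages {ρ = ρ})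

  den-fold-vertices : ∀ {k} (ρ : Vec Tree k) z b →
    den I (fold vertices z b) ρ ≡
    foldr (λ i acc → den I b (⌜ toℕ i ⌝ⁿ ∷ᵛ acc ∷ᵛ ρ)) (den I z ρ) (allFin n)
  den-fold-vertices ρ z b = den-fold vertices z b (n≤1+n n) (den-vertices {ρ = ρ})

  -- Booleans reflecting the same proposition agree, so the test of the term can be exchanged for
  -- `does P?`, and the loops become a `filter`.
  den-emit : ∀ {k P} {c e : Term (2 + k)} {x acc t} {ρ : Vec Tree k} (P? : Dec P) →
    Holds (x ∷ᵛ acc ∷ᵛ ρ) c P → den I e (x ∷ᵛ acc ∷ᵛ ρ) ≡ t →
    den I (emit c e) (x ∷ᵛ acc ∷ᵛ ρ) ≡ (Bool.if does P? then t ∙ acc else acc)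
  den-emit P? (holds r) eq rewrite eq | det r (proof P?) = refl

  module _ {k : ℕ} {ρ : Vec Tree k} where

    -- The specification quantifies over the accumulators because they belong to the environment in
    -- which `c` and `e` are evaluated.
    den-pairs : {P : Pred (Fin (suc n) × Fin n) 0ℓ} (P? : Decidable P)
      (enc : Fin (suc n) × Fin n → Tree)
      (c e : Term (4 + k)) →
      (∀ i x acc acc′ → let σ = ⌜ toℕ x ⌝ⁿ ∷ᵛ acc ∷ᵛ ⌜ toℕ i ⌝ⁿ ∷ᵛ acc′ ∷ᵛ ρ in
        Holds σ c (P (i , x)) × den I e σ ≡ enc (i , x)) →
      den I (pairsᵗ c e) ρ ≡
      ⌜ map enc (filter P? (cartesianProduct (allFin (suc n)) (allFin n))) ⌝ˡ
    den-pairs P? enc c e spec = begin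
      den I (pairsᵗ c e) ρ
        ≡⟨ den-fold-stages ρ nil (fold vertices (var 1F) (emit c e)) ⟩
      foldr (λ i acc → den I (fold vertices (var 1F) (emit c e)) (⌜ toℕ i ⌝ⁿ ∷ᵛ acc ∷ᵛ ρ))
        nil (allFin (suc n))
        ≡⟨ foldr-cong (λ i acc → trans
             (den-fold-vertices _ (var 1F) (emit c e))
             (foldr-cong (λ x acc′ →
               let r , eq = spec i x acc′ acc in den-emit {c = c} {e} (P? (i , x)) r eq)
               refl (allFin n)))
             refl (allFin (suc n)) ⟩
      foldr (λ i acc → foldr (λ x → step (i , x)) acc (allFin n)) nil (allFin (suc n))
        ≡⟨ foldr-product step nil (allFin (suc n)) (allFin n) ⟩
      foldr step nil (cartesianProduct (allFin (suc n)) (allFin n))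
        ≡⟨ foldr-filter P? enc (cartesianProduct (allFin (suc n)) (allFin n)) ⟩
      ⌜ map enc (filter P? (cartesianProduct (allFin (suc n)) (allFin n))) ⌝ˡ ∎
      where
      open ≡-Reasoning
      step : _ → Tree → Tree
      step y acc = Bool.if does (P? y) then enc y ∙ acc else acc

    den-triples : {P : Pred (Fin n × Fin n × Fin n) 0ℓ} (P? : Decidable P)
      (enc : Fin n × Fin n × Fin n → Tree)
      (c e : Term (6 + k)) →
      (∀ j a b acc acc′ acc″ →
        let σ = ⌜ toℕ b ⌝ⁿ ∷ᵛ acc ∷ᵛ ⌜ toℕ a ⌝ⁿ ∷ᵛ acc′ ∷ᵛ ⌜ toℕ j ⌝ⁿ ∷ᵛ acc″ ∷ᵛ ρ in
        Holds σ c (P (j , a , b)) × den I e σ ≡ enc (j , a , b)) →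
      den I (triplesᵗ c e) ρ ≡
      ⌜ map enc (filter P? (cartesianProduct (allFin n) (cartesianProduct (allFin n) (allFin n)))) ⌝ˡ
    den-triples P? enc c e spec = begin
      den I (triplesᵗ c e) ρ
        ≡⟨ den-fold-vertices ρ nil (fold vertices (var 1F) (fold vertices (var 1F) (emit c e))) ⟩
      foldr _ nil (allFin n)
        ≡⟨ foldr-cong (λ j acc″ → trans
             (den-fold-vertices _ (var 1F) (fold vertices (var 1F) (emit c e)))
             (trans
               (foldr-cong (λ a acc′ → trans
                 (den-fold-vertices _ (var 1F) (emit c e))
                 (foldr-cong (λ b acc →
                   let r , eq = spec j a b acc acc′ acc″ in den-emit {c = c} {e} (P? (j , a , b)) r eq)
                   refl (allFin n)))
                 refl (allFin n))
               (foldr-product (λ ab → step (j , ab)) acc″ (allFin n) (allFin n))))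
             refl (allFin n) ⟩
      foldr (λ j acc → foldr (λ ab → step (j , ab)) acc pairs) nil (allFin n)
        ≡⟨ foldr-product step nil (allFin n) pairs ⟩
      foldr step nil (cartesianProduct (allFin n) pairs)
        ≡⟨ foldr-filter P? enc (cartesianProduct (allFin n) pairs) ⟩
      ⌜ map enc (filter P? (cartesianProduct (allFin n) pairs)) ⌝ˡ ∎
      where
      open ≡-Reasoning
      pairs = cartesianProduct (allFin n) (allFin n)
      step : _ → Tree → Tree
      step y acc = Bool.if does (P? y) then enc y ∙ acc else acc

  edge : Fin n × Fin n × Fin n → Edge (Fin n × ℕ)
  edge (j , a , b) = ⟨ (a , toℕ j) , (b , suc (toℕ j)) , suc (toℕ j) ⟩

  -- Follows `allowedᵗ` conjunct by conjunct, so that the reflection lemmas compose along the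
  -- syntax.
  Allowed : Fin n → ℕ → Pred (Fin n × Fin n × Fin n) 0ℓ
  Allowed u l (j , a , b) =
    Adj a b × Ok v a (toℕ j) × Ok v b (suc (toℕ j)) ×
    ¬ (a ≡ u × 0 < toℕ j × toℕ j < l) × ¬ (b ≡ u × suc (toℕ j) < l)

  allowed? : ∀ u l → Decidable (Allowed u l)
  allowed? u l (j , a , b) =
    T? (adjacent a b) ×-dec ok? v a (toℕ j) ×-dec ok? v b (suc (toℕ j)) ×-dec
    ¬? (a ≟ᶠ u ×-dec 0 <? toℕ j ×-dec toℕ j <? l) ×-dec ¬? (b ≟ᶠ u ×-dec suc (toℕ j) <? l)

  triples : List (Fin n × Fin n × Fin n)
  triples = cartesianProduct (allFin n) (cartesianProduct (allFin n) (allFin n))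

  pairs : List (Fin (suc n) × Fin n)
  pairs = cartesianProduct (allFin (suc n)) (allFin n)

  edgesAvoiding : Fin n → ℕ → List (Edge (Fin n × ℕ))
  edgesAvoiding u l = map edge (filter (allowed? u l) triples)

  -- `s` and `t` are evaluated inside three folds, so their values may not depend on the six
  -- variables bound there.
  den-edges : ∀ {k} {ρ : Vec Tree k} s t {u l} →
    (∀ r₀ r₁ r₂ r₃ r₄ r₅ → let σ = r₀ ∷ᵛ r₁ ∷ᵛ r₂ ∷ᵛ r₃ ∷ᵛ r₄ ∷ᵛ r₅ ∷ᵛ ρ in
      Number σ s (toℕ u) × Number σ t l) →
    den I (edgesᵗ s t) ρ ≡ encodeEdges encodeVertex (edgesAvoiding u l)
  den-edges s t {u} {l} spec =
    trans
      (den-triples (allowed? u l) (encodeEdge encodeVertex ∘ edge) (allowedᵗ s t) edgeᵗ λ j a b acc acc′ acc″ →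
        let u# , l# = spec ⌜ toℕ b ⌝ⁿ acc ⌜ toℕ a ⌝ⁿ acc′ ⌜ toℕ j ⌝ⁿ acc″
            b# = _#≤_ {t = var 0F} refl (toℕ≤1+n b)
            a# = _#≤_ {t = var 2F} refl (toℕ≤1+n a)
            j# = _#≤_ {t = var 4F} refl (toℕ≤1+n j)
            j+1# = _#≤_ {t = cons nil (var 4F)} refl (s≤s (toℕ≤n j))
        in
        ∧-holds (adjacent-holds a# b#)
          (∧-holds (ok-holds a# j#)
            (∧-holds (ok-holds b# j+1#)
              (∧-holds
                (not-holds (∧-holds (≡ᶠ-holds a# u#) (∧-holds (positive-holds j#) (<-holds j# l#))))
                (not-holds (∧-holds (≡ᶠ-holds b# u#) (<-holds j+1# l#)))))) ,
        refl)
      (cong ⌜_⌝ˡ (map-∘ (filter (allowed? u l) triples)))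

  vertexOk? : Decidable (λ ((i , x) : Fin (suc n) × Fin n) → Ok v x (toℕ i))
  vertexOk? (i , x) = ok? v x (toℕ i)

  labelled? : Decidable (λ ((i , x) : Fin (suc n) × Fin n) → toℕ i ≢ 0 × Ok v x (toℕ i))
  labelled? (i , x) = ¬? (toℕ i ≟ 0) ×-dec ok? v x (toℕ i)

  stagedVertices : List (ℕ × (Fin n × ℕ))
  stagedVertices = map (λ (i , x) → toℕ i , (x , toℕ i)) (filter vertexOk? pairs)

  labelEntry : Fin (suc n) × Fin n → (Fin n × ℕ) × List (Edge (Fin n × ℕ))
  labelEntry (i , x) = (x , toℕ i) , edgesAvoiding x (toℕ i)

  labelEntries : List ((Fin n × ℕ) × List (Edge (Fin n × ℕ)))
  labelEntries = map labelEntry (filter labelled? pairs)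

  den-staged : den I stagedᵗ []ᵛ ≡ ⌜ map (λ (i , x) → ⌜ i ⌝ⁿ ∙ encodeVertex x) stagedVertices ⌝ˡ
  den-staged = trans
    (den-pairs {ρ = []ᵛ} vertexOk? _ (okᵗ (var 0F) (var 2F)) (cons (var 2F) (cons (var 0F) (var 2F)))
      λ i x acc acc′ →
      ok-holds (_#≤_ {t = var 0F} refl (toℕ≤1+n x)) (_#≤_ {t = var 2F} refl (toℕ≤n i)) , refl)
    (cong ⌜_⌝ˡ (map-∘ (filter vertexOk? pairs)))

  den-labels : den I labelsᵗ []ᵛ ≡
    ⌜ map (λ (x , es) → encodeVertex x ∙ encodeEdges encodeVertex es) labelEntries ⌝ˡ
  den-labels = trans
    (den-pairs {ρ = []ᵛ} labelled? _ (var 2F ∧ᵗ okᵗ (var 0F) (var 2F)) entryᵗ λ i x acc acc′ →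
      ∧-holds (nonzero-holds (_#≤_ {t = var 2F} refl (toℕ≤n i)))
        (ok-holds (_#≤_ {t = var 0F} refl (toℕ≤1+n x)) (_#≤_ {t = var 2F} refl (toℕ≤n i))) ,
      cong (encodeVertex (x , toℕ i) ∙_)
        (den-edges {ρ = ⌜ toℕ x ⌝ⁿ ∷ᵛ acc ∷ᵛ ⌜ toℕ i ⌝ⁿ ∷ᵛ acc′ ∷ᵛ []ᵛ} (var 6F) (var 8F)
          λ _ _ _ _ _ _ → refl #≤ toℕ≤1+n x , refl #≤ toℕ≤n i))
    (cong ⌜_⌝ˡ (map-∘ (filter labelled? pairs)))

  den-transform : den I transform []ᵛ ≡
    ⌜ n ⌝ⁿ ∙ encodeVertex (v , 0) ∙ encodeVertex (v , n)
      ∙ ⌜ map (λ (i , x) → ⌜ i ⌝ⁿ ∙ encodeVertex x) stagedVertices ⌝ˡ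
      ∙ encodeEdges encodeVertex (edgesAvoiding v 0)
      ∙ ⌜ map (λ (x , es) → encodeVertex x ∙ encodeEdges encodeVertex es) labelEntries ⌝ˡ
  den-transform =
    cong₂ _∙_ (den-order {ρ = []ᵛ}) (cong₂ _∙_ refl (cong₂ _∙_
      (cong (⌜ toℕ v ⌝ⁿ ∙_) (den-order {ρ = []ᵛ}))
      (cong₂ _∙_ den-staged (cong₂ _∙_
        (den-edges {ρ = []ᵛ} start nil λ _ _ _ _ _ _ → start-number , refl #≤ z≤n)
        den-labels))))

-- Correctness of the output

-- For order 1 the stages 1 and n coincide, as do n - 1 and 0; this rules the case out wherever `v`
-- has a neighbour.
Fin1-unique : ∀ {k} → k ≡ 0 → (x y : Fin (suc k)) → x ≡ y
Fin1-unique refl zero zero = refl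

lists-map-filter : ∀ {A B : Set} {P : Pred B 0ℓ} {Q : Pred A 0ℓ} (Q? : Decidable Q)
  (f : A → B) {xs} →
  (∀ {x y} → f x ≡ f y → x ≡ y) → Unique xs → (∀ x → x ∈ xs) →
  (∀ x → Q x → P (f x)) → (∀ y → P y → ∃ λ x → y ≡ f x × Q x) →
  Lists P (map f (filter Q? xs))
lists-map-filter {P = P} Q? f {xs} inj unique complete Q⇒P P⇒Q = record
  { unique = Unique-map⁺ inj (Unique-filter⁺ Q? unique)
  ; exact  = mk⇔ to from
  }
  where
  to : ∀ {y} → y ∈ map f (filter Q? xs) → P y
  to y∈ with x , x∈ , refl ← ∈-map⁻ f y∈ = Q⇒P x (proj₂ (∈-filter⁻ Q? {xs = xs} x∈))

  from : ∀ {y} → P y → y ∈ map f (filter Q? xs)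
  from p with x , refl , q ← P⇒Q _ p = ∈-map⁺ f (∈-filter⁺ Q? (complete x) q)

module Correctness {m : ℕ} (G : Graph (suc m)) (v : Fin (suc m)) where

  open Graph G
  open Construction G v using (Stage′; E′; Label′)
  open Stage′
  open E′
  open Label′
  open Denotation G v
  open LabeledMultistageGraph (G′ G v) using (V)

  n : ℕ
  n = suc m

  inner-ok : ∀ {u l} → u ≢ v → 1 ≤ l → l ≤ m → Ok v u l
  inner-ok u≢v 1≤l l≤m =
    (λ u≡v → contradiction u≡v u≢v) ,
    λ { (inj₁ refl) → contradiction 1≤l (n≮n 0) ; (inj₂ refl) → contradiction l≤m (n≮n m) }

  ok-inner : ∀ {u l} → Ok v u l → u ≢ v → l ≤ n → 1 ≤ l × l ≤ m
  ok-inner ok u≢v l≤n =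
    n≢0⇒n>0 (u≢v ∘ proj₂ ok ∘ inj₁) , s≤s⁻¹ (≤∧≢⇒< l≤n (u≢v ∘ proj₂ ok ∘ inj₂))

  stage⇒ok : ∀ {i x} → Stage′ i x → proj₂ x ≡ i × Ok v (proj₁ x) i
  stage⇒ok source               = refl , (λ _ → inj₁ refl) , λ _ → refl
  stage⇒ok (inner u≢v 1≤l l≤m)  = refl , inner-ok u≢v 1≤l l≤m
  stage⇒ok sink                 = refl , (λ _ → inj₂ refl) , λ _ → refl

  ok⇒stage : ∀ {i u} → i ≤ n → Ok v u i → Stage′ i (u , i)
  ok⇒stage {u = u} i≤n ok with u ≟ᶠ v
  ... | no u≢v = let 1≤i , i≤m = ok-inner ok u≢v i≤n in inner u≢v 1≤i i≤m
  ... | yes refl with proj₁ ok refl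
  ...   | inj₁ refl = source
  ...   | inj₂ refl = sink

  adjacent⇒≢ : ∀ {a b} → Adj a b → a ≢ b
  adjacent⇒≢ {a} adj refl = subst T (irreflexive a) adj

  adj-sym : ∀ {a b} → Adj a b → Adj b a
  adj-sym {a} {b} = subst T (symmetric a b)

  Joins : ℕ → Fin n → Fin n → Set
  Joins j a b = Adj a b × Ok v a j × Ok v b (suc j)

  edgeAt : ℕ → Fin n → Fin n → Edge (Fin n × ℕ)
  edgeAt j a b = ⟨ (a , j) , (b , suc j) , suc j ⟩

  between : ∀ {a b l} → Adj a b → a ≢ v → b ≢ v → 1 ≤ l → l ≤ m ∸ 1 → l < n × Joins l a b
  between {l = l} adj a≢v b≢v 1≤l l≤ =
    s≤s l≤m , adj , inner-ok a≢v 1≤l l≤m , inner-ok b≢v (s≤s z≤n) l<m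
    where
    l≤m = ≤-trans l≤ (m∸n≤m m 1)
    -- Since `m ∸ 1` is truncated, strictness needs `1 ≤ l`: if `l` were `m`, then `l ≤ l ∸ 1` with
    -- `l` positive.
    l<m = ≤∧≢⇒< l≤m λ { refl → <-irrefl refl (≤-<-trans l≤ (∸-monoʳ-< {l} (s≤s z≤n) 1≤l)) }

  -- Brings the four kinds of edge to one form; for `backward` and `return` the ends are exchanged
  -- by symmetry of adjacency.
  edge⇒joins : ∀ {e} → E′ e → ∃ λ j → ∃₂ λ a b → e ≡ edgeAt j a b × j < n × Joins j a b
  edge⇒joins (forward adj a≢v b≢v 1≤l l≤)  = _ , _ , _ , refl , between adj a≢v b≢v 1≤l l≤
  edge⇒joins (backward adj a≢v b≢v 1≤l l≤) = _ , _ , _ , refl , between (adj-sym adj) b≢v a≢v 1≤l l≤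
  edge⇒joins (leave {b} adj) =
    0 , v , b , refl , s≤s z≤n , adj , proj₂ (stage⇒ok source) ,
    (λ b≡v → contradiction (sym b≡v) v≢b) ,
    λ { (inj₁ ()) ; (inj₂ refl) → contradiction (Fin1-unique refl v b) v≢b }
    where
    v≢b = adjacent⇒≢ adj
  edge⇒joins (return {b} adj) =
    m , b , v , refl , ≤-refl , adj-sym adj ,
    ((λ b≡v → contradiction (sym b≡v) v≢b) ,
     λ { (inj₁ m≡0) → contradiction (Fin1-unique m≡0 v b) v≢b
       ; (inj₂ m≡1+m) → contradiction (sym m≡1+m) 1+n≢n }) ,
    proj₂ (stage⇒ok sink)
    where
    v≢b = adjacent⇒≢ adj

  -- If the source lies over `v`, then `j < n` puts it in stage 0; if the target does, its positive
  -- stage must be n. Otherwise both ends are inner, and `forward` applies to the ordered pair.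
  joins⇒edge : ∀ {j a b} → j < n → Joins j a b → E′ (edgeAt j a b)
  joins⇒edge {j} {a} {b} j<n (adj , ok-a , ok-b) with a ≟ᶠ v
  ... | yes refl with proj₁ ok-a refl
  ...   | inj₁ refl = leave adj
  ...   | inj₂ refl = contradiction j<n (n≮n n)
  joins⇒edge {j} {a} {b} j<n (adj , ok-a , ok-b) | no a≢v with b ≟ᶠ v
  ... | yes refl with proj₁ ok-b refl
  ...   | inj₂ refl = return (adj-sym adj)
  joins⇒edge {j} {a} {b} j<n (adj , ok-a , ok-b) | no a≢v | no b≢v =
    forward adj a≢v b≢v (proj₁ (ok-inner ok-a a≢v (<⇒≤ j<n)))
      -- The target is inner, so `suc j ≤ m`, which gives `j ≤ m ∸ 1`, that is `n ∸ 2`.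
      (∸-monoˡ-≤ 1 (proj₂ (ok-inner ok-b b≢v j<n)))

  Avoids : ℕ → Fin n → Fin n → Fin n → ℕ → Set
  Avoids j a b u l = ¬ (a ≡ u × 0 < j × j < l) × ¬ (b ≡ u × suc j < l)


  -- The rule for `D` excludes no edge, in agreement with `Avoids`: edges meet copies of `v` only at
  -- the stages 0 and n, never strictly between.
  label⇒avoids : ∀ {j a b u l} → j < n → Joins j a b → Label′ (u , l) (edgeAt j a b) →
                 Avoids j a b u l
  label⇒avoids j<n _ (inner _ _ _ miss) =
    (λ { (refl , 0<j , j<l) → miss _ 0<j (<⇒≤pred j<l) (inj₁ refl) }) ,
    (λ { (refl , j<l) → miss _ (s≤s z≤n) (<⇒≤pred j<l) (inj₂ refl) })
  label⇒avoids {a = a} {b} j<n (adj , ok-a , ok-b) (sink _) = not-a , not-b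
    where
    not-a : ¬ (a ≡ v × _)
    not-a (a≡v , 0<j , _) with proj₁ ok-a a≡v
    ... | inj₁ refl = n≮n 0 0<j
    ... | inj₂ refl = n≮n n j<n
    not-b : ¬ (b ≡ v × _)
    not-b (b≡v , j<) with proj₁ ok-b b≡v
    ... | inj₂ refl = n≮n n j<

  avoids⇒label : ∀ {j a b u l} → l ≤ n → l ≢ 0 → Ok v u l → E′ (edgeAt j a b) → Avoids j a b u l →
                 Label′ (u , l) (edgeAt j a b)
  avoids⇒label {u = u} {l} l≤n l≢0 ok e (not-a , not-b) with u ≟ᶠ v
  ... | yes refl with proj₁ ok refl
  ...   | inj₁ l≡0  = contradiction l≡0 l≢0
  ...   | inj₂ refl = sink e
  avoids⇒label {l = zero}  l≤n l≢0 ok e (not-a , not-b) | no u≢v = contradiction refl l≢0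
  avoids⇒label {l = suc l} l≤n l≢0 ok e (not-a , not-b) | no u≢v =
    inner (s≤s z≤n) (proj₂ (ok-inner ok u≢v l≤n)) e λ
      { k 1≤k k≤ (inj₁ refl) → not-a (refl , 1≤k , s≤s k≤)
      ; k 1≤k k≤ (inj₂ refl) → not-b (refl , s≤s k≤) }

  edge-injective : ∀ {x y} → edge x ≡ edge y → x ≡ y
  edge-injective {_ , a , b} {_ , c , d} eq
    with refl ← cong (proj₁ ∘ src) eq
       | refl ← cong (proj₁ ∘ tgt) eq
       | refl ← toℕ-injective (cong (proj₂ ∘ src) eq) = refl

  triples-unique : Unique triples
  triples-unique = cartesianProduct⁺ (allFin⁺ n) (cartesianProduct⁺ (allFin⁺ n) (allFin⁺ n))

  triples-complete : ∀ x → x ∈ triples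
  triples-complete (j , a , b) = ∈-cartesianProduct⁺ (∈-allFin j) (∈-cartesianProduct⁺ (∈-allFin a) (∈-allFin b))

  pairs-unique : Unique pairs
  pairs-unique = cartesianProduct⁺ (allFin⁺ (suc n)) (allFin⁺ n)

  pairs-complete : ∀ x → x ∈ pairs
  pairs-complete (i , x) = ∈-cartesianProduct⁺ (∈-allFin i) (∈-allFin x)

  -- Stated for any set `P` of edges so as to serve for `E′` itself and for every label.
  edgesAvoiding-lists : ∀ {P : Pred (Edge (Fin n × ℕ)) 0ℓ} {u l} →
    (∀ {e} → P e → E′ e) →
    (∀ {j a b} → j < n → Joins j a b → P (edgeAt j a b) → Avoids j a b u l) →
    (∀ {j a b} → j < n → Joins j a b → Avoids j a b u l → P (edgeAt j a b)) →
    Lists P (edgesAvoiding u l)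
  edgesAvoiding-lists {P} {u} {l} P⇒E P⇒avoids avoids⇒P =
    lists-map-filter (allowed? u l) edge edge-injective triples-unique triples-complete to from
    where
    to : ∀ x → Allowed u l x → P (edge x)
    to (j , _ , _) (adj , ok-a , ok-b , avoids) = avoids⇒P (toℕ<n j) (adj , ok-a , ok-b) avoids

    from : ∀ e → P e → ∃ λ x → e ≡ edge x × Allowed u l x
    from e p with edge⇒joins (P⇒E p)
    ... | j , a , b , refl , j<n , joins
      -- Abstracting the index together with its equation lets `refl` replace `j` by `toℕ i`.
      with P⇒avoids j<n joins p | fromℕ< j<n | toℕ-fromℕ< j<n
    ... | avoids | i | refl = let adj , ok-a , ok-b = joins in
      (i , a , b) , refl , adj , ok-a , ok-b , avoids

  edges-listed : Lists E′ (edgesAvoiding v 0)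
  edges-listed = edgesAvoiding-lists id (λ _ _ _ → (λ ()) , λ ()) (λ j<n joins _ → joins⇒edge j<n joins)

  label-listed : ∀ {u l} → l ≤ n → l ≢ 0 → Ok v u l → Lists (Label′ (u , l)) (edgesAvoiding u l)
  label-listed l≤n l≢0 ok =
    edgesAvoiding-lists (λ { (inner _ _ e _) → e ; (sink e) → e }) label⇒avoids
      (λ j<n joins → avoids⇒label l≤n l≢0 ok (joins⇒edge j<n joins))

  stages-listed : Lists (λ (i , x) → i ≤ n × Stage′ i x) stagedVertices
  stages-listed =
    lists-map-filter vertexOk? _ inj pairs-unique pairs-complete
      (λ (i , x) ok → toℕ≤pred[n] i , ok⇒stage (toℕ≤pred[n] i) ok) from
    where
    inj : ∀ {x y : Fin (suc n) × Fin n} →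
      _≡_ {A = ℕ × (Fin n × ℕ)} (toℕ (proj₁ x) , proj₂ x , toℕ (proj₁ x))
        (toℕ (proj₁ y) , proj₂ y , toℕ (proj₁ y)) → x ≡ y
    inj {x} {y} eq
      with refl ← toℕ-injective {i = proj₁ x} {proj₁ y} (cong proj₁ eq)
         | refl ← cong (proj₁ ∘ proj₂) eq = refl
    from : (y : ℕ × (Fin n × ℕ)) → proj₁ y ≤ n × Stage′ (proj₁ y) (proj₂ y) →
      ∃ λ ((i , x) : Fin (suc n) × Fin n) → y ≡ (toℕ i , x , toℕ i) × Ok v x (toℕ i)
    from (i , (x , _)) (i≤n , st)
      with stage⇒ok st | fromℕ< (s≤s i≤n) | toℕ-fromℕ< (s≤s i≤n)
    ... | refl , ok | j | refl = (j , x) , refl , ok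

  labelled-listed : Lists (λ x → V x × x ≢ (v , 0)) (map proj₁ labelEntries)
  labelled-listed =
    subst (Lists _) (map-∘ (filter labelled? pairs))
      (lists-map-filter labelled? _ inj pairs-unique pairs-complete
        (λ (i , x) (i≢0 , ok) → (_ , toℕ≤pred[n] i , ok⇒stage (toℕ≤pred[n] i) ok) , i≢0 ∘ cong proj₂) from)
    where
    inj : ∀ {x y : Fin (suc n) × Fin n} →
      _≡_ {A = Fin n × ℕ} (proj₂ x , toℕ (proj₁ x)) (proj₂ y , toℕ (proj₁ y)) → x ≡ y
    inj {x} {y} eq
      with refl ← toℕ-injective {i = proj₁ x} {proj₁ y} (cong proj₂ eq)
         | refl ← cong proj₁ eq = refl
    from : (y : Fin n × ℕ) → V y × y ≢ (v , 0) →
      ∃ λ ((i , x) : Fin (suc n) × Fin n) → y ≡ (x , toℕ i) × toℕ i ≢ 0 × Ok v x (toℕ i)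
    from (x , _) ((i , i≤n , st) , ≢S)
      with stage⇒ok st | fromℕ< (s≤s i≤n) | toℕ-fromℕ< (s≤s i≤n)
    ... | refl , ok | j | refl =
      -- At stage 0 admissibility forces `x ≡ v`, so the vertex would be `S`.
      (j , x) , refl , (λ j≡0 → ≢S (trans (cong (x ,_) j≡0) (cong (_, 0) (proj₂ ok (inj₁ j≡0))))) , ok

  represents : Represents encodeVertex (G′ G v) (den I transform []ᵛ)
  represents = record
    { vertexList  = stagedVertices
    ; edgeList    = edgesAvoiding v 0
    ; labelList   = labelEntries
    ; vertices-ok = stages-listed
    ; edges-ok    = edges-listed
    ; labelled-ok = labelled-listed
    ; labels-ok   = All-map⁺ (All.map (λ {(i , x)} (i≢0 , ok) →
                        label-listed (toℕ≤pred[n] i) i≢0 ok)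
                      (all-filter labelled? pairs))
    ; tree-ok     = den-transform
    }

theorem5 : Σ Program λ P → Σ Polynomial λ p →
    (n : ℕ) (G : Graph n) (v : Fin n) →
    ∃₂ λ output time →
    Runs P (encodeInput G v) output time
    × Represents encodeVertex (G′ G v) output
    × time ≤ ⟦ p ⟧ n
-- The 2 pays for the final move of the result to register 0.
theorem5 = termProgram transform , poly transform ⊕ const 2 , λ
  -- A graph of order 0 has no vertex to select.
  { zero    G ()
  ; (suc m) G v →
      let time , runs , time≤ = termProgram-runs transform (Denotation.clock G v)
      in _ , time , runs , Correctness.represents G v , time≤
  }
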